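{- Consider the mesh patterns $$m_1=(12,\{(0,0),(0,1),(1,1),(1,2),(2,0),(2,1)\}),$$ $$m_2=(21,\{(0,0),(0,1),(1,1),(1,2),(2,0),(2,1)\}),$$ $$m_3=(21,\{(0,1),(0,2),(1,0),(1,1),(1,2),(2,1)\}),$$ $$m_4=(21,\{(0,1),(0,2),(1,0),(1,1),(1,2),(2,0)\}).$$ These four patterns are Wilf-equivalent under $231$: for all $n\ge0$ the numbers $|\mathrm{Av}_n(\{231,m_i\})|$, $i=1,2,3,4$, are equal. Moreover their common generating function $P(x)=\sum_{n\ge0}|\mathrm{Av}_n(\{231,m_i\})|x^n$ satisfies $$P(x)=1+xP(x)M(x),\qquad M(x)=1+xC(x)(C(x)-1),$$ where $C(x)$ is the Catalan generating function, i.e. the power series satisfying $C(x)=1+xC(x)^2$.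
   Context: Write $[n]=\{1,\dots,n\}$. A permutation of length $n$ is a bijection of $[n]$, written in one-line notation; $G(\pi)=\{(i,\pi(i)) : i\in[n]\}$ is its plot. A mesh pattern of length $k$ is a pair $p=(\tau,R)$ with $\tau$ a permutation of length $k$ and $R\subseteq\{0,\dots,k\}^2$. An occurrence of $p$ in a permutation $\pi$ of length $n$ is a subset $\omega\subseteq G(\pi)$ for which there are order-preserving injections $\alpha,\beta:[k]\to[n]$ such that (i) $\omega=\{(\alpha(i),\beta(j)):(i,j)\in G(\tau)\}$, and (ii) with $\alpha(0)=\beta(0)=0$, $\alpha(k+1)=\beta(k+1)=n+1$ and $R_{ij}=[\alpha(i)+1,\alpha(i+1)-1]\times[\beta(j)+1,\beta(j+1)-1]$, one has $R_{ij}\cap G(\pi)=\emptyset$ for every $(i,j)\in R$. A permutation avoids $p$ if it has no occurrence of $p$. A classical pattern $\pi$ is identified with the mesh pattern $(\pi,\emptyset)$. $\mathrm{Av}_n(S)$ is the set of all permutations of length $n$ (including the empty permutation for $n=0$) avoiding every pattern in $S$. -}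

module Defs where

open import Data.Fin.Base as Fin using (Fin; zero; suc; toℕ; inject₁)
open import Data.Fin.Patterns using (0F; 1F; 2F; 3F)
open import Data.Fin.Permutation using (Permutation′; permutation; _⟨$⟩ʳ_; id; transpose)
open import Data.Integer.Base as ℤ using (ℤ; 0ℤ; 1ℤ)
open import Data.Integer.Properties using (+-0-commutativeMonoid)
open import Data.List.Base using (List; []; _∷_)
open import Data.List.Membership.Propositional using () renaming (_∈_ to _∈ᴸ_)
open import Data.List.Relation.Unary.All using (All)
open import Data.Nat.Base as ℕ using (ℕ; zero; suc; _∸_)
open import Data.Product.Base using (Σ-syntax; ∃-syntax; _×_; _,_; proj₁)
open import Function.Base using (_∘_)
open import Function.Bundles using (Inverse)
open import Function.Definitions using (Injective)
open import Level using (0ℓ) renaming (suc to lsuc)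
open import Relation.Binary.Bundles using (Setoid)
open import Relation.Binary.Core using (_Preserves_⟶_)
open import Relation.Binary.PropositionalEquality using (_≡_; refl; setoid; _→-setoid_)
open import Relation.Nullary.Negation.Core using (¬_)
open import Relation.Unary using (Pred; _∈_; _⊆_; _≐_; _∩_; Empty)
import Algebra.Properties.CommutativeMonoid.Sum as Sum
import Relation.Binary.Construct.On as On

private
  variable
    k n : ℕ

------------------------------------------------------------------------
-- Permutations and mesh patterns

-- The set [n] = {1,…,n} is represented by Fin n; ⟦ x ⟧ is the element of
-- {1,…,n} that x : Fin n stands for.
⟦_⟧ : Fin n → ℕ
⟦ x ⟧ = suc (toℕ x)

G : Permutation′ n → Pred (Fin n × Fin n) 0ℓ
G π (x , y) = π ⟨$⟩ʳ x ≡ y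

-- A cell (i , j) of {0,…,k}² is an element of Fin (suc k) × Fin (suc k),
-- without any shift of indices; the set R is given by listing its elements.
record MeshPattern : Set where
  constructor mesh
  field
    {size} : ℕ
    τ      : Permutation′ size
    R      : List (Fin (suc size) × Fin (suc size))

classical : Permutation′ k → MeshPattern
classical τ = mesh τ []

record OrderPreservingInjection (f : Fin k → Fin n) : Set where
  field
    mono      : f Preserves Fin._≤_ ⟶ Fin._≤_
    injective : Injective _≡_ _≡_ f

snoc : (Fin k → ℕ) → ℕ → Fin (suc k) → ℕ
snoc {zero}  f b _       = b
snoc {suc k} f b zero    = f zero
snoc {suc k} f b (suc i) = snoc (f ∘ suc) b i

-- α on {0,…,k+1}, extended by α(0) = 0 and α(k+1) = n+1.
extend : (Fin k → Fin n) → Fin (suc (suc k)) → ℕ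
extend         α zero    = 0
extend {n = n} α (suc i) = snoc (⟦_⟧ ∘ α) (suc n) i

-- x ∈ [α(i)+1, α(i+1)−1]
Between : (Fin k → Fin n) → Fin (suc k) → Pred (Fin n) 0ℓ
Between α i x = extend α (inject₁ i) ℕ.< ⟦ x ⟧ × ⟦ x ⟧ ℕ.< extend α (suc i)

Region : (α β : Fin k → Fin n) → Fin (suc k) × Fin (suc k) → Pred (Fin n × Fin n) 0ℓ
Region α β (i , j) (x , y) = x ∈ Between α i × y ∈ Between β j

-- { (α(i), β(j)) : (i, j) ∈ G(τ) }
Image : (α β : Fin k → Fin n) → Permutation′ k → Pred (Fin n × Fin n) 0ℓ
Image α β τ (x , y) = ∃[ i ] ∃[ j ] ((i , j) ∈ G τ × α i ≡ x × β j ≡ y)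

record IsOccurrence (p : MeshPattern) (π : Permutation′ n)
                    (ω : Pred (Fin n × Fin n) 0ℓ) : Set where
  open MeshPattern p
  field
    ω⊆G   : ω ⊆ G π
    α β   : Fin size → Fin n
    α-opi : OrderPreservingInjection α
    β-opi : OrderPreservingInjection β
    image : ω ≐ Image α β τ
    empty : ∀ {c} → c ∈ᴸ R → Empty (Region α β c ∩ G π)

Avoids : Permutation′ n → MeshPattern → Set₁
Avoids π p = ∀ ω → ¬ IsOccurrence p π ω

-- A setoid, since two permutations are the same when they agree pointwise,
-- irrespective of the proofs carried by their representations.
Av : ℕ → List MeshPattern → Setoid (lsuc 0ℓ) 0ℓ
Av n S = On.setoid (Fin n →-setoid Fin n) to
  where
  to : Σ[ π ∈ Permutation′ n ] All (Avoids π) S → Fin n → Fin n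
  to (π , _) = π ⟨$⟩ʳ_

∣_∣≡_ : Setoid (lsuc 0ℓ) 0ℓ → ℕ → Set₁
∣ A ∣≡ c = Inverse A (setoid (Fin c))

------------------------------------------------------------------------
-- The patterns at hand

π₁₂ π₂₁ : Permutation′ 2
π₁₂ = id
π₂₁ = transpose 0F 1F

π₂₃₁ : Permutation′ 3
π₂₃₁ = permutation
  (λ { 0F → 1F ; 1F → 2F ; 2F → 0F })
  (λ { 0F → 2F ; 1F → 0F ; 2F → 1F })
  (λ { 0F → refl ; 1F → refl ; 2F → refl })
  (λ { 0F → refl ; 1F → refl ; 2F → refl })

m₁ m₂ m₃ m₄ : MeshPattern
m₁ = mesh π₁₂ ((0F , 0F) ∷ (0F , 1F) ∷ (1F , 1F) ∷ (1F , 2F) ∷ (2F , 0F) ∷ (2F , 1F) ∷ [])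
m₂ = mesh π₂₁ ((0F , 0F) ∷ (0F , 1F) ∷ (1F , 1F) ∷ (1F , 2F) ∷ (2F , 0F) ∷ (2F , 1F) ∷ [])
m₃ = mesh π₂₁ ((0F , 1F) ∷ (0F , 2F) ∷ (1F , 0F) ∷ (1F , 1F) ∷ (1F , 2F) ∷ (2F , 1F) ∷ [])
m₄ = mesh π₂₁ ((0F , 1F) ∷ (0F , 2F) ∷ (1F , 0F) ∷ (1F , 1F) ∷ (1F , 2F) ∷ (2F , 0F) ∷ [])

-- The index 0F, …, 3F stands for 1, …, 4.
m : Fin 4 → MeshPattern
m 0F = m₁
m 1F = m₂
m 2F = m₃
m 3F = m₄

------------------------------------------------------------------------
-- Formal power series over ℤ, as coefficient sequences

PowerSeries : Set
PowerSeries = ℕ → ℤ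

open Sum +-0-commutativeMonoid using (sum⁺-syntax)

infix  4 _≈_
infixl 6 _+_ _-_
infixl 7 _*_

_≈_ : PowerSeries → PowerSeries → Set
f ≈ g = ∀ n → f n ≡ g n

_+_ _-_ _*_ : PowerSeries → PowerSeries → PowerSeries
(f + g) n = f n ℤ.+ g n
(f - g) n = f n ℤ.- g n
(f * g) n = ∑[ i ≤ n ] (f (toℕ i) ℤ.* g (n ∸ toℕ i))

𝟙 : PowerSeries
𝟙 zero    = 1ℤ
𝟙 (suc _) = 0ℤ

X : PowerSeries
X zero          = 0ℤ
X (suc zero)    = 1ℤ
X (suc (suc _)) = 0ℤ

-- Σₙ aₙ xⁿ
generatingFunction : (ℕ → ℕ) → PowerSeries
generatingFunction a n = ℤ.+ a n

IsCatalanGF : PowerSeries → Set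
IsCatalanGF C = C ≈ 𝟙 + X * (C * C)

M : PowerSeries → PowerSeries
M C = 𝟙 + X * C * (C - 𝟙)

{-# OPTIONS --safe #-}

-- Splitting a 231-avoiding permutation at its first entry writes it uniquely
-- as (1 ⊖ σ) ⊕ ρ with σ, ρ avoiding 231, so these permutations are binary
-- trees and are counted by C.  Within (1 ⊖ σ) ⊕ ρ, avoidance of mᵢ reads:
--   m₁ : σ avoids m₁ and ρ is not of the form 1 ⊕ ρ′;
--   m₂ : σ avoids m₂ and is not of the form σ′ ⊕ 1;
--   m₃ : ρ avoids m₃ and σ is not of the form 1 ⊖ σ′;
--   m₄ : ρ avoids m₄ and σ is not of the form 1 ⊕ σ′.
-- The permutations not of the form 1 ⊖ σ′ are counted by M, and so are those
-- not of the form 1 ⊕ σ′, which gives P = 1 + xPM for m₁, m₃ and m₄.  For m₂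
-- the condition falls twice on σ and never on ρ; exchanging the trailing
-- summands 1 of σ with those of ρ moves "not of the form σ′ ⊕ 1" over to ρ.

module Submission where

open import Axiom.UniquenessOfIdentityProofs using (module Decidable⇒UIP)
open import Data.Bool.Base using (Bool; true; false; _∧_)
open import Data.Bool.Properties using (¬-not)
open import Data.Empty using (⊥; ⊥-elim)
open import Data.Fin.Base as Fin using (Fin; zero; suc; toℕ; fromℕ<)
open import Data.Fin.Patterns using (0F; 1F; 2F; 3F)
open import Data.Fin.Permutation using (Permutation′; _⟨$⟩ˡ_; _⟨$⟩ʳ_; inverseˡ; inverseʳ; ↔⇒≡)
open import Data.Fin.Properties
  using (toℕ<n; toℕ-fromℕ<; fromℕ<-toℕ; toℕ-injective; injective⇒≤; +↔⊎; *↔×)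
open import Data.Integer.Base as ℤ using (ℤ; 0ℤ; 1ℤ)
open import Data.List.Base using (List; []; _∷_)
open import Data.List.Membership.Propositional using () renaming (_∈_ to _∈ᴸ_)
open import Data.List.Relation.Unary.All as All using (All; []; _∷_)
open import Data.Nat.Base as ℕ using (ℕ; zero; suc; _∸_; _<_; _≤_; s≤s; z<s; s<s)
open import Data.Nat.Induction using (<-rec)
open import Data.Nat.Properties
open import Data.Nat.Solver using (module +-*-Solver)
open import Data.Product.Base using (Σ-syntax; ∃-syntax; _×_; _,_; proj₁; proj₂; map; swap; uncurry)
open import Data.Product.Function.NonDependent.Propositional using (_×-↔_)
open import Data.Sum.Base as Sum using (_⊎_; inj₁; inj₂)
open import Data.Sum.Function.Propositional using (_⊎-↔_)
open import Function.Base using (_∘_; id)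
open import Function.Bundles using (_↔_; mk↔ₛ′; Inverse)
open import Function.Construct.Composition using (inverse; _↔-∘_)
open import Function.Construct.Identity using (↔-id)
open import Function.Construct.Symmetry using (↔-sym)
open import Function.Definitions using (Injective)
open import Relation.Binary.Bundles using (Setoid)
open import Relation.Binary.Definitions using (tri<; tri≈; tri>)
open import Relation.Binary.PropositionalEquality
open import Relation.Nullary.Decidable.Core using (Dec; yes; no)
open import Relation.Nullary.Negation.Core using (¬_; contradiction)
open import Relation.Unary using (Empty; _∩_)
open import Defs
import Algebra.Properties.CommutativeMonoid.Sum as CommutativeMonoidSum
import Data.Bool.Properties as Bool
import Data.Fin.Properties as Fin
import Data.Integer.Properties as ℤ

-- Occurrences are decided on trees alone, whose points carry two abstract orders; coordinates enter
-- only when trees are compared with permutations. In (1 ⊖ σ) ⊕ ρ the root lies to the left of and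
-- below ρ, and to the left of and above σ. Hence the cell (0 , 0), shaded in m₁ and m₂, rules out
-- every occurrence inside ρ, and (0 , 2), shaded in m₃ and m₄, every one inside σ; in the other
-- block occurrences are inherited unchanged. The remaining condition comes from occurrences that
-- use the root. M counts the trees that are empty or have a nonempty second subtree, whence 1 +
-- xC(C - 1). Up to a size-preserving bijection on pairs of subtrees, each of the four predicates
-- splits a node into itself and a predicate counted by M; so all four share one recurrence, and the
-- equation for P is that recurrence read coefficientwise.

open ≡-Reasoning
module ℕΣ = CommutativeMonoidSum +-0-commutativeMonoid
module ℤΣ = CommutativeMonoidSum ℤ.+-0-commutativeMonoid

-- Permutations avoiding 231

-- leaf is the empty permutation, and node s t is (1 ⊖ s) ⊕ t.
data Tree : Set where
  leaf : Tree
  node : Tree → Tree → Tree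

size : Tree → ℕ
size leaf       = 0
size (node s t) = suc (size s ℕ.+ size t)

data Point : Tree → Set where
  root  : ∀ {s t} → Point (node s t)
  left  : ∀ {s t} → Point s → Point (node s t)
  right : ∀ {s t} → Point t → Point (node s t)

-- p <ˣ q when p is to the left of q in the plot, p <ʸ q when p is below q.
infix 4 _<ˣ_ _<ʸ_

data _<ˣ_ : ∀ {t} → Point t → Point t → Set where
  root<left   : ∀ {s t} {p : Point s} → root {s} {t} <ˣ left p
  root<right  : ∀ {s t} {p : Point t} → root {s} {t} <ˣ right p
  left<right  : ∀ {s t} {p : Point s} {q : Point t} → left p <ˣ right q
  left<left   : ∀ {s t} {p q : Point s} → p <ˣ q → left {s} {t} p <ˣ left q
  right<right : ∀ {s t} {p q : Point t} → p <ˣ q → right {s} {t} p <ˣ right q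

data _<ʸ_ : ∀ {t} → Point t → Point t → Set where
  left<root   : ∀ {s t} {p : Point s} → left {s} {t} p <ʸ root
  root<right  : ∀ {s t} {p : Point t} → root {s} {t} <ʸ right p
  left<right  : ∀ {s t} {p : Point s} {q : Point t} → left p <ʸ right q
  left<left   : ∀ {s t} {p q : Point s} → p <ʸ q → left {s} {t} p <ʸ left q
  right<right : ∀ {s t} {p q : Point t} → p <ʸ q → right {s} {t} p <ʸ right q

-- A step to the right into `t` lands above everything outside `t`, so the three points of a 231
-- would have to share a subtree.
no-231 : ∀ {t} {p q r : Point t} → p <ˣ q → q <ˣ r → r <ʸ p → p <ʸ q → ⊥
no-231 root<right      (right<right _) ()              _
no-231 left<right      (right<right _) ()              _
no-231 (left<left a)   left<right      ()              _
no-231 (left<left a)   (left<left b)   (left<left c)   (left<left d)   = no-231 a b c d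
no-231 (right<right a) (right<right b) (right<right c) (right<right d) = no-231 a b c d

-- Mesh patterns of length 2 in trees

Strip : {A : Set} → (A → A → Set) → A → A → Fin 3 → A → Set
Strip _<_ a b 0F r = r < a
Strip _<_ a b 1F r = a < r × r < b
Strip _<_ a b 2F r = b < r

module _ {A B : Set} {_<₁_ : A → A → Set} {_<₂_ : B → B → Set} {f : A → B} {a b r : A} where

  strip⁺ : (∀ {x y} → x <₁ y → f x <₂ f y) →
           ∀ i → Strip _<₁_ a b i r → Strip _<₂_ (f a) (f b) i (f r)
  strip⁺ mono 0F u       = mono u
  strip⁺ mono 1F (u , v) = mono u , mono v
  strip⁺ mono 2F u       = mono u

  strip⁻ : (∀ {x y} → f x <₂ f y → x <₁ y) →
           ∀ i → Strip _<₂_ (f a) (f b) i (f r) → Strip _<₁_ a b i r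
  strip⁻ cancel 0F u       = cancel u
  strip⁻ cancel 1F (u , v) = cancel u , cancel v
  strip⁻ cancel 2F u       = cancel u

-- The cell (i , j) cut out by the columns of p, q and the rows of lo, hi
-- contains no point.
Clear : ∀ {t} (p q lo hi : Point t) → Fin 3 × Fin 3 → Set
Clear p q lo hi (i , j) = ∀ r → Strip _<ˣ_ p q i r → Strip _<ʸ_ lo hi j r → ⊥

pick : {A : Set} → A → A → Fin 2 → A
pick p q 0F = p
pick p q 1F = q

pick-map : {A B : Set} (f : A → B) {p q : A} → ∀ j → f (pick p q j) ≡ pick (f p) (f q) j
pick-map f 0F = refl
pick-map f 1F = refl

-- `p`, `q` are the two points by column and `lo`, `hi` the same two by row; the inverse of `τ`
-- tells which column holds a given row. With `lo` and `hi` as fields of their own, `Clear` can be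
-- stated independently of `τ`.
record Occurs (τ : Permutation′ 2) (R : List (Fin 3 × Fin 3)) (t : Tree) : Set where
  constructor occurs
  field
    {p q lo hi} : Point t
    lo≡   : lo ≡ pick p q (τ ⟨$⟩ˡ 0F)
    hi≡   : hi ≡ pick p q (τ ⟨$⟩ˡ 1F)
    p<q   : p <ˣ q
    lo<hi : lo <ʸ hi
    clear : All (Clear p q lo hi) R

module _ {s t : Tree} where

  left-cancelˣ : ∀ {p q : Point s} → left {s} {t} p <ˣ left q → p <ˣ q
  left-cancelˣ (left<left l) = l

  left-cancelʸ : ∀ {p q : Point s} → left {s} {t} p <ʸ left q → p <ʸ q
  left-cancelʸ (left<left l) = l

  right-cancelˣ : ∀ {p q : Point t} → right {s} {t} p <ˣ right q → p <ˣ q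
  right-cancelˣ (right<right l) = l

  right-cancelʸ : ∀ {p q : Point t} → right {s} {t} p <ʸ right q → p <ʸ q
  right-cancelʸ (right<right l) = l

  clear-left⁻ : ∀ {R} (p q lo hi : Point s) →
                All (Clear (left {s} {t} p) (left q) (left lo) (left hi)) R → All (Clear p q lo hi) R
  clear-left⁻ _ _ _ _ = All.map λ {(i , j)} e r u v →
    e (left r) (strip⁺ left<left i u) (strip⁺ left<left j v)

  clear-right⁻ : ∀ {R} (p q lo hi : Point t) →
                 All (Clear (right {s} {t} p) (right q) (right lo) (right hi)) R → All (Clear p q lo hi) R
  clear-right⁻ _ _ _ _ = All.map λ {(i , j)} e r u v →
    e (right r) (strip⁺ right<right i u) (strip⁺ right<right j v)

  -- The root and the points of t are above those of s: among the cells cut out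
  -- by points of s they only lie in (0 , 2) and (2 , 2).
  clear-left⁺ : ∀ {p q lo hi : Point s} {c} → c ≢ (0F , 2F) → c ≢ (2F , 2F) → Clear p q lo hi c →
                Clear (left {s} {t} p) (left q) (left lo) (left hi) c
  clear-left⁺ {c = i , j} _ _ e (left r) u v = e r (strip⁻ left-cancelˣ i u) (strip⁻ left-cancelʸ j v)
  clear-left⁺ {c = 0F , 2F} ≢02 _ e root u v = ≢02 refl
  clear-left⁺ {c = 2F , 2F} _ ≢22 e (right r) u v = ≢22 refl
  clear-left⁺ {c = 0F , 0F} _ _ e root u ()
  clear-left⁺ {c = 0F , 1F} _ _ e root u ()
  clear-left⁺ {c = 1F , j} _ _ e root (() , _) v
  clear-left⁺ {c = 2F , j} _ _ e root () v
  clear-left⁺ {c = 0F , j} _ _ e (right r) () v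
  clear-left⁺ {c = 1F , j} _ _ e (right r) (_ , ()) v
  clear-left⁺ {c = 2F , 0F} _ _ e (right r) u ()
  clear-left⁺ {c = 2F , 1F} _ _ e (right r) u ()

  -- The root and the points of `s` lie to the left of and below all of `t`, so they can only meet
  -- the cell (0 , 0).
  clear-right⁺ : ∀ {p q lo hi : Point t} {c} → c ≢ (0F , 0F) → Clear p q lo hi c →
                 Clear (right {s} {t} p) (right q) (right lo) (right hi) c
  clear-right⁺ {c = i , j} _ e (right r) u v = e r (strip⁻ right-cancelˣ i u) (strip⁻ right-cancelʸ j v)
  clear-right⁺ {c = 0F , 0F} ≢00 e _ u v = ≢00 refl
  clear-right⁺ {c = 0F , 1F} _ e root u ()
  clear-right⁺ {c = 0F , 2F} _ e root u ()
  clear-right⁺ {c = 1F , j} _ e root (() , _) v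
  clear-right⁺ {c = 2F , j} _ e root () v
  clear-right⁺ {c = 0F , 1F} _ e (left r) u ()
  clear-right⁺ {c = 0F , 2F} _ e (left r) u ()
  clear-right⁺ {c = 1F , j} _ e (left r) (() , _) v
  clear-right⁺ {c = 2F , j} _ e (left r) () v

  occurs-left : ∀ {τ R} → All (λ c → c ≢ (0F , 2F) × c ≢ (2F , 2F)) R →
                Occurs τ R s → Occurs τ R (node s t)
  occurs-left {τ} ok (occurs refl refl p<q lo<hi cs) =
    occurs (pick-map left (τ ⟨$⟩ˡ 0F)) (pick-map left (τ ⟨$⟩ˡ 1F)) (left<left p<q) (left<left lo<hi)
      (All.zipWith (λ ((≢02 , ≢22) , e) → clear-left⁺ ≢02 ≢22 e) (ok , cs))

  occurs-right : ∀ {τ R} → All (_≢ (0F , 0F)) R → Occurs τ R t → Occurs τ R (node s t)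
  occurs-right {τ} ok (occurs refl refl p<q lo<hi cs) =
    occurs (pick-map right (τ ⟨$⟩ˡ 0F)) (pick-map right (τ ⟨$⟩ˡ 1F)) (right<right p<q) (right<right lo<hi)
      (All.zipWith (λ (≢00 , e) → clear-right⁺ ≢00 e) (ok , cs))

-- Avoidance of the four patterns, recursively

nonleaf : Tree → Bool
nonleaf leaf       = false
nonleaf (node _ _) = true

-- μ t holds when t is not of the form 1 ⊖ s.
μ : Tree → Bool
μ leaf       = true
μ (node _ t) = nonleaf t

-- Turns "not of the form 1 ⊕ s" into `μ`: an empty first subtree becomes an empty second one, at
-- equal size.
mirror : Tree → Tree
mirror leaf       = leaf
mirror (node s t) = node t s

-- In snoc form, node l r stands for l ⊕ (1 ⊖ r), where l but not r is again in
-- snoc form.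
prepend : Tree → Tree → Tree
prepend s leaf       = node leaf s
prepend s (node l r) = node (prepend s l) r

snocForm : Tree → Tree
snocForm leaf       = leaf
snocForm (node s t) = prepend s (snocForm t)

avoids : Fin 4 → Tree → Bool
avoids _  leaf       = true
avoids 0F (node s t) = avoids 0F s ∧ μ (mirror t)
avoids 1F (node s t) = avoids 1F s ∧ μ (snocForm s)
avoids 2F (node s t) = avoids 2F t ∧ μ s
avoids 3F (node s t) = avoids 3F t ∧ μ (mirror s)

∧-true : ∀ {a b} → a ∧ b ≡ true → a ≡ true × b ≡ true
∧-true {true} {true} _ = refl , refl

∧-false : ∀ {a b} → a ∧ b ≡ false → a ≡ false ⊎ b ≡ false
∧-false {false} _ = inj₁ refl
∧-false {true}  e = inj₂ e

-- In snoc form `μ` looks only at the last block, which a block prepended to a nonempty tree leaves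
-- alone.
μ-snocForm : ∀ s t u → μ (snocForm (node s (node t u))) ≡ μ (snocForm (node t u))
μ-snocForm s t u with snocForm u
... | leaf     = refl
... | node _ _ = refl

-- In snoc form, failure of μ means being of the form l ⊕ 1.
last-max : ∀ t → μ (snocForm t) ≡ false → Σ[ q ∈ Point t ] ∀ r → ¬ q <ˣ r × ¬ q <ʸ r
last-max (node leaf leaf) _ = root , λ { root → (λ ()) , (λ ()) }
last-max (node s (node t u)) e
  with q , above ← last-max (node t u) (trans (sym (μ-snocForm s t u)) e) = right q , λ where
    root      → (λ ()) , (λ ())
    (left _)  → (λ ()) , (λ ())
    (right r) → (λ { (right<right l) → proj₁ (above r) l }) , (λ { (right<right l) → proj₂ (above r) l })

-- The three alternatives are shaped after m₂ with the root as first point: right and above, right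
-- and below, left and above put `r` into the shaded cells (2 , 1), (2 , 0) and (1 , 1).
no-last-max : ∀ t → μ (snocForm t) ≡ true → (q : Point t) →
              ∃[ r ] ((q <ˣ r × (q <ʸ r ⊎ r <ʸ q)) ⊎ (r <ˣ q × q <ʸ r))
no-last-max (node (node _ _) leaf) _ root     = left root , inj₁ (root<left , inj₂ left<root)
no-last-max (node _ leaf)          _ (left q) = root , inj₂ (root<left , left<root)
no-last-max (node s (node t u))    e root     = right root , inj₁ (root<right , inj₁ root<right)
no-last-max (node s (node t u))    e (left q) = right root , inj₁ (left<right , inj₁ left<right)
no-last-max (node s (node t u))    e (right q)
  with r , x ← no-last-max (node t u) (trans (sym (μ-snocForm s t u)) e) q =
  right r , Sum.map (map right<right (Sum.map right<right right<right)) (map right<right right<right) x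

R₁₂ R₃ R₄ : List (Fin 3 × Fin 3)
R₁₂ = MeshPattern.R m₁
R₃ = MeshPattern.R m₃
R₄ = MeshPattern.R m₄

no-upper-corners : All (λ c → c ≢ (0F , 2F) × c ≢ (2F , 2F)) R₁₂
no-upper-corners = ((λ ()) , (λ ())) ∷ ((λ ()) , (λ ())) ∷ ((λ ()) , (λ ())) ∷ ((λ ()) , (λ ()))
                 ∷ ((λ ()) , (λ ())) ∷ ((λ ()) , (λ ())) ∷ []

-- If `t` is 1 ⊕ u, the root and the root of `t` have consecutive values, and only points of `s`,
-- all lower, stand between their columns.
m₁-occurs : ∀ t → avoids 0F t ≡ false → Occurs π₁₂ R₁₂ t
m₁-occurs (node s t) e with ∧-false {avoids 0F s} e
... | inj₁ e₁ = occurs-left no-upper-corners (m₁-occurs s e₁)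
m₁-occurs (node s (node leaf t)) _ | inj₂ _ =
  occurs {p = root} {q = right root} refl refl root<right root<right
    ( (λ { _ () _ }) ∷ (λ { _ () _ })
    ∷ (λ { (right root) (_ , right<right ()) _ ; (right (right _)) (_ , right<right ()) _
         ; (left _) _ (() , _) })
    ∷ (λ { (left _) _ () ; (right root) (_ , right<right ()) _
         ; (right (right _)) (_ , right<right ()) _ })
    ∷ (λ { (right (right _)) _ () })
    ∷ (λ { (right (right _)) _ (_ , right<right ()) })
    ∷ [])

-- An ascent from the root to a deeper point of `t` has the root of `t` in (1 , 2) or (1 , 1); one
-- from `s` into `t` has the root in (0 , 1); one within `t` has it in (0 , 0). What is left is the
-- pair of roots, or an ascent within `s`.
m₁-avoids : ∀ t → avoids 0F t ≡ true → ¬ Occurs π₁₂ R₁₂ t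
m₁-avoids (node s (node leaf u)) e (occurs {q = right root} refl refl root<right _ _)
  with () ← proj₂ (∧-true {avoids 0F s} e)
m₁-avoids (node s (node (node _ _) u)) _
  (occurs {q = right root} refl refl root<right _ (_ ∷ _ ∷ _ ∷ _ ∷ _ ∷ c₂₁ ∷ [])) =
  c₂₁ (right (left root)) (right<right root<left) (root<right , right<right left<root)
m₁-avoids (node s (node _ _)) _
  (occurs {q = right (left q)} refl refl root<right _ (_ ∷ _ ∷ _ ∷ c₁₂ ∷ _)) =
  c₁₂ (right root) (root<right , right<right root<left) (right<right left<root)
m₁-avoids (node s (node _ _)) _
  (occurs {q = right (right q)} refl refl root<right _ (_ ∷ _ ∷ c₁₁ ∷ _)) =
  c₁₁ (right root) (root<right , right<right root<right) (root<right , right<right root<right)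
m₁-avoids (node s t) e (occurs refl refl left<right _ (_ ∷ c₀₁ ∷ _)) =
  c₀₁ root root<left (left<root , root<right)
m₁-avoids (node s t) e (occurs {left p} {left q} refl refl (left<left p<q) (left<left lo<hi) cs) =
  m₁-avoids s (proj₁ (∧-true e)) (occurs refl refl p<q lo<hi (clear-left⁻ p q p q cs))
m₁-avoids (node s t) e (occurs refl refl (right<right p<q) (right<right lo<hi) (c₀₀ ∷ _)) =
  c₀₀ root root<right root<right

-- The new occurrence pairs the root with the last and largest point of `s`: nothing in `s` is to
-- its right or above it, and `t` lies entirely in the unshaded cell (2 , 2).
m₂-occurs : ∀ t → avoids 1F t ≡ false → Occurs π₂₁ R₁₂ t
m₂-occurs (node s t) e with ∧-false {avoids 1F s} e
... | inj₁ e₁ = occurs-left no-upper-corners (m₂-occurs s e₁)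
... | inj₂ e₂ with q , above ← last-max s e₂ =
  occurs {p = root} {q = left q} refl refl root<left left<root
    ( (λ { _ () _ }) ∷ (λ { _ () _ })
    ∷ (λ { (left r) _ (left<left l , _) → proj₂ (above r) l ; root (() , _) _ })
    ∷ (λ { (right r) (_ , ()) _ })
    ∷ (λ { (left r) (left<left l) _ → proj₁ (above r) l })
    ∷ (λ { (left r) (left<left l) _ → proj₁ (above r) l })
    ∷ [])

m₂-avoids : ∀ t → avoids 1F t ≡ true → ¬ Occurs π₂₁ R₁₂ t
m₂-avoids (node s t) e
  (occurs refl refl (root<left {p = q}) left<root (_ ∷ _ ∷ c₁₁ ∷ _ ∷ c₂₀ ∷ c₂₁ ∷ []))
  with no-last-max s (proj₂ (∧-true e)) q
... | r , inj₁ (x , inj₁ y) = c₂₁ (left r) (left<left x) (left<left y , left<root)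
... | r , inj₁ (x , inj₂ y) = c₂₀ (left r) (left<left x) (left<left y)
... | r , inj₂ (x , y) = c₁₁ (left r) (root<left , left<left x) (left<left y , left<root)
m₂-avoids (node s t) e (occurs {left p} {left q} refl refl (left<left p<q) (left<left lo<hi) cs) =
  m₂-avoids s (proj₁ (∧-true e)) (occurs refl refl p<q lo<hi (clear-left⁻ p q q p cs))
m₂-avoids (node s t) e (occurs refl refl (right<right p<q) (right<right lo<hi) (c₀₀ ∷ _)) =
  c₀₀ root root<right root<right

-- Both m₃ and m₄ shade the whole middle column, so their occurrences consist of neighbouring
-- entries; the entry next to the root is the first one of `s`.
root-left-adjacent : ∀ {s t u} {r : Point (node (node s t) u)} → root <ˣ r → ¬ r <ˣ left root
root-left-adjacent root<left (left<left ())

m₃-occurs : ∀ t → avoids 2F t ≡ false → Occurs π₂₁ R₃ t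
m₃-occurs (node s t) e with ∧-false {avoids 2F t} e
... | inj₁ e₁ = occurs-right ((λ ()) ∷ (λ ()) ∷ (λ ()) ∷ (λ ()) ∷ (λ ()) ∷ (λ ()) ∷ []) (m₃-occurs t e₁)
m₃-occurs (node (node _ leaf) t) _ | inj₂ _ =
  occurs {p = root} {q = left root} refl refl root<left left<root
    ( (λ { _ () _ }) ∷ (λ { _ () _ })
    ∷ (λ _ (u , v) _ → root-left-adjacent u v)
    ∷ (λ _ (u , v) _ → root-left-adjacent u v)
    ∷ (λ _ (u , v) _ → root-left-adjacent u v)
    ∷ (λ { (left (left _)) _ (left<left () , _) ; (left (right ())) ; root () _ ; (right _) _ (_ , ()) })
    ∷ [])

-- A descent from the root past the first entry of `s` leaves that entry in the middle column, and a
-- descent within `s` has the root in (0 , 2). For the first entry of `s` itself, (2 , 1) meets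
-- exactly the second subtree of `s`.
m₃-avoids : ∀ t → avoids 2F t ≡ true → ¬ Occurs π₂₁ R₃ t
m₃-avoids (node (node s leaf) t) e (occurs {q = left root} refl refl root<left _ _)
  with () ← proj₂ (∧-true {avoids 2F t} e)
m₃-avoids (node (node s (node _ _)) t) _
  (occurs {q = left root} refl refl root<left _ (_ ∷ _ ∷ _ ∷ _ ∷ _ ∷ c₂₁ ∷ [])) =
  c₂₁ (left (right root)) (left<left root<right) (left<left root<right , left<root)
m₃-avoids (node _ t) _ (occurs {q = left (left _)} refl refl root<left _ (_ ∷ _ ∷ _ ∷ c₁₁ ∷ _)) =
  c₁₁ (left root) (root<left , left<left root<left) (left<left left<root , left<root)
m₃-avoids (node _ t) _ (occurs {q = left (right _)} refl refl root<left _ (_ ∷ _ ∷ c₁₀ ∷ _)) =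
  c₁₀ (left root) (root<left , left<left root<right) (left<left root<right)
m₃-avoids (node _ t) _ (occurs refl refl (left<left _) (left<left _) (_ ∷ c₀₂ ∷ _)) =
  c₀₂ root root<left left<root
m₃-avoids (node _ t) e (occurs {right p} {right q} refl refl (right<right p<q) (right<right lo<hi) cs) =
  m₃-avoids t (proj₁ (∧-true e)) (occurs refl refl p<q lo<hi (clear-right⁻ p q q p cs))

m₄-occurs : ∀ t → avoids 3F t ≡ false → Occurs π₂₁ R₄ t
m₄-occurs (node s t) e with ∧-false {avoids 3F t} e
... | inj₁ e₁ = occurs-right ((λ ()) ∷ (λ ()) ∷ (λ ()) ∷ (λ ()) ∷ (λ ()) ∷ (λ ()) ∷ []) (m₄-occurs t e₁)
m₄-occurs (node (node leaf _) t) _ | inj₂ _ =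
  occurs {p = root} {q = left root} refl refl root<left left<root
    ( (λ { _ () _ }) ∷ (λ { _ () _ })
    ∷ (λ _ (u , v) _ → root-left-adjacent u v)
    ∷ (λ _ (u , v) _ → root-left-adjacent u v)
    ∷ (λ _ (u , v) _ → root-left-adjacent u v)
    ∷ (λ { (left (left ())) ; (left (right _)) _ (left<left ())
         ; (left root) (left<left ()) ; (right _) _ () })
    ∷ [])

-- As for m₃, except that the last cell is (2 , 0), which meets exactly the first subtree of `s`.
m₄-avoids : ∀ t → avoids 3F t ≡ true → ¬ Occurs π₂₁ R₄ t
m₄-avoids (node (node leaf _) t) e (occurs {q = left root} refl refl root<left _ _)
  with () ← proj₂ (∧-true {avoids 3F t} e)
m₄-avoids (node (node (node _ _) _) t) _
  (occurs {q = left root} refl refl root<left _ (_ ∷ _ ∷ _ ∷ _ ∷ _ ∷ c₂₀ ∷ [])) =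
  c₂₀ (left (left root)) (left<left root<left) (left<left left<root)
m₄-avoids (node _ t) _ (occurs {q = left (left _)} refl refl root<left _ (_ ∷ _ ∷ _ ∷ c₁₁ ∷ _)) =
  c₁₁ (left root) (root<left , left<left root<left) (left<left left<root , left<root)
m₄-avoids (node _ t) _ (occurs {q = left (right _)} refl refl root<left _ (_ ∷ _ ∷ c₁₀ ∷ _)) =
  c₁₀ (left root) (root<left , left<left root<right) (left<left root<right)
m₄-avoids (node _ t) _ (occurs refl refl (left<left _) (left<left _) (_ ∷ c₀₂ ∷ _)) =
  c₀₂ root root<left left<root
m₄-avoids (node _ t) e (occurs {right p} {right q} refl refl (right<right p<q) (right<right lo<hi) cs) =
  m₄-avoids t (proj₁ (∧-true e)) (occurs refl refl p<q lo<hi (clear-right⁻ p q q p cs))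

-- Trees as permutations

-- The preorder and the inorder rank of a vertex.
column row : ∀ {t} → Point t → ℕ
column root          = 0
column (left p)      = suc (column p)
column (right {s} p) = suc (size s ℕ.+ column p)
row (root {s})       = size s
row (left p)         = row p
row (right {s} p)    = suc (size s ℕ.+ row p)

column<size : ∀ {t} (p : Point t) → column p < size t
column<size root          = z<s
column<size (left p)      = s<s (m≤n⇒m≤n+o _ (column<size p))
column<size (right {s} p) = s<s (+-monoʳ-< (size s) (column<size p))

row<size : ∀ {t} (p : Point t) → row p < size t
row<size root          = s≤s (m≤m+n _ _)
row<size (left p)      = m≤n⇒m≤1+n (m≤n⇒m≤n+o _ (row<size p))
row<size (right {s} p) = s<s (+-monoʳ-< (size s) (row<size p))

column-mono : ∀ {t} {p q : Point t} → p <ˣ q → column p < column q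
column-mono root<left            = z<s
column-mono root<right           = z<s
column-mono (left<right {p = p}) = s<s (m≤n⇒m≤n+o _ (column<size p))
column-mono (left<left l)        = s<s (column-mono l)
column-mono (right<right {s} l)  = s<s (+-monoʳ-< (size s) (column-mono l))

row-mono : ∀ {t} {p q : Point t} → p <ʸ q → row p < row q
row-mono (left<root {p = p})  = row<size p
row-mono root<right           = s≤s (m≤m+n _ _)
row-mono (left<right {p = p}) = m≤n⇒m≤1+n (m≤n⇒m≤n+o _ (row<size p))
row-mono (left<left l)        = row-mono l
row-mono (right<right {s} l)  = s<s (+-monoʳ-< (size s) (row-mono l))

Connex : {A : Set} → (A → A → Set) → Set
Connex _≺_ = ∀ p q → p ≺ q ⊎ p ≡ q ⊎ q ≺ p

connexˣ : ∀ {t} → Connex (_<ˣ_ {t})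
connexˣ root      root      = inj₂ (inj₁ refl)
connexˣ root      (left _)  = inj₁ root<left
connexˣ root      (right _) = inj₁ root<right
connexˣ (left _)  root      = inj₂ (inj₂ root<left)
connexˣ (left p)  (left q)  = Sum.map left<left (Sum.map (cong left) left<left) (connexˣ p q)
connexˣ (left _)  (right _) = inj₁ left<right
connexˣ (right _) root      = inj₂ (inj₂ root<right)
connexˣ (right _) (left _)  = inj₂ (inj₂ left<right)
connexˣ (right p) (right q) = Sum.map right<right (Sum.map (cong right) right<right) (connexˣ p q)

connexʸ : ∀ {t} → Connex (_<ʸ_ {t})
connexʸ root      root      = inj₂ (inj₁ refl)
connexʸ root      (left _)  = inj₂ (inj₂ left<root)
connexʸ root      (right _) = inj₁ root<right
connexʸ (left _)  root      = inj₁ left<root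
connexʸ (left p)  (left q)  = Sum.map left<left (Sum.map (cong left) left<left) (connexʸ p q)
connexʸ (left _)  (right _) = inj₁ left<right
connexʸ (right _) root      = inj₂ (inj₂ root<right)
connexʸ (right _) (left _)  = inj₂ (inj₂ left<right)
connexʸ (right p) (right q) = Sum.map right<right (Sum.map (cong right) right<right) (connexʸ p q)

<+⇒split : ∀ m {n i} → i < m ℕ.+ n → i < m ⊎ (∃[ j ] (j < n × i ≡ m ℕ.+ j))
<+⇒split zero            i<n       = inj₂ (_ , i<n , refl)
<+⇒split (suc m) {i = 0} _         = inj₁ z<s
<+⇒split (suc m) {i = suc i} (s<s l) =
  Sum.map s<s (λ (j , j<n , eq) → j , j<n , cong suc eq) (<+⇒split m l)

column-onto : ∀ t {i} → i < size t → Σ[ p ∈ Point t ] column p ≡ i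
column-onto (node s t) {zero}  _       = root , refl
column-onto (node s t) {suc i} (s<s l) with <+⇒split (size s) l
... | inj₁ i<s              = map left (cong suc) (column-onto s i<s)
... | inj₂ (j , j<t , refl) = map right (cong (λ k → suc (size s ℕ.+ k))) (column-onto t j<t)

row-onto : ∀ t {i} → i < size t → Σ[ p ∈ Point t ] row p ≡ i
-- Moving the successor to the second summand makes the root the offset zero above `s`.
row-onto (node s t) {i} l with <+⇒split (size s) (subst (i <_) (sym (+-suc (size s) (size t))) l)
... | inj₁ i<s                      = map left id (row-onto s i<s)
... | inj₂ (zero , _ , refl)        = root , sym (+-identityʳ (size s))
... | inj₂ (suc j , s<s j<t , refl) =
  map right (λ eq → trans (cong (λ k → suc (size s ℕ.+ k)) eq) (sym (+-suc (size s) j))) (row-onto t j<t)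

module Ranking {A : Set} {_≺_ : A → A → Set} (connex : Connex _≺_) {n : ℕ} (f : A → ℕ)
               (f<n : ∀ p → f p < n) (f-mono : ∀ {p q} → p ≺ q → f p < f q)
               (f-onto : ∀ {i} → i < n → Σ[ p ∈ A ] f p ≡ i) where

  injective : ∀ {p q} → f p ≡ f q → p ≡ q
  injective {p} {q} eq with connex p q
  ... | inj₁ l        = contradiction (f-mono l) (<-irrefl eq)
  ... | inj₂ (inj₁ e) = e
  ... | inj₂ (inj₂ l) = contradiction (f-mono l) (<-irrefl (sym eq))

  f-cancel : ∀ {p q} → f p < f q → p ≺ q
  f-cancel {p} {q} l with connex p q
  ... | inj₁ r           = r
  ... | inj₂ (inj₁ refl) = contradiction l (<-irrefl refl)
  ... | inj₂ (inj₂ r)    = contradiction l (<-asym (f-mono r))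

  rank : A ↔ Fin n
  rank = mk↔ₛ′ to from
    (λ i → toℕ-injective (trans (toℕ-fromℕ< _) (proj₂ (f-onto (toℕ<n i)))))
    (λ p → injective (trans (proj₂ (f-onto (toℕ<n (to p)))) (toℕ-fromℕ< (f<n p))))
    where
    to : A → Fin n
    to p = fromℕ< (f<n p)
    from : Fin n → A
    from i = proj₁ (f-onto (toℕ<n i))

module Rˣ t = Ranking (connexˣ {t}) column column<size column-mono (column-onto t)
module Rʸ t = Ranking (connexʸ {t}) row row<size row-mono (row-onto t)

toPermutation : ∀ t → Permutation′ (size t)
toPermutation t = Rʸ.rank t ↔-∘ ↔-sym (Rˣ.rank t)

-- Extension by the identity, which neither destroys bijectivity nor creates an
-- occurrence of 231.
extendℕ : ∀ {n} → (Fin n → Fin n) → ℕ → ℕ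
extendℕ {n} f i with i <? n
... | yes i<n = toℕ (f (fromℕ< i<n))
... | no  _   = i

module _ {n} (f : Fin n → Fin n) where

  extendℕ-< : ∀ {i} (i<n : i < n) → extendℕ f i ≡ toℕ (f (fromℕ< i<n))
  extendℕ-< {i} i<n with i <? n
  ... | yes _  = refl
  ... | no i≮n = contradiction i<n i≮n

  extendℕ-toℕ : ∀ i → extendℕ f (toℕ i) ≡ toℕ (f i)
  extendℕ-toℕ i = trans (extendℕ-< (toℕ<n i)) (cong (toℕ ∘ f) (fromℕ<-toℕ i (toℕ<n i)))

  extendℕ-≮ : ∀ {i} → ¬ i < n → extendℕ f i ≡ i
  extendℕ-≮ {i} i≮n with i <? n
  ... | yes i<n = contradiction i<n i≮n
  ... | no _    = refl

extendℕ-inverse : ∀ {n} (f g : Fin n → Fin n) → (∀ i → g (f i) ≡ i) → ∀ i → extendℕ g (extendℕ f i) ≡ i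
extendℕ-inverse {n} f g gf i with i <? n
... | yes i<n = trans (extendℕ-toℕ g _) (trans (cong toℕ (gf _)) (toℕ-fromℕ< i<n))
... | no i≮n  = extendℕ-≮ g i≮n

extendℕ-cong : ∀ {n} {f g : Fin n → Fin n} → (∀ i → f i ≡ g i) → ∀ i → extendℕ f i ≡ extendℕ g i
extendℕ-cong {n} f≗g i with i <? n
... | yes i<n = cong toℕ (f≗g _)
... | no _    = refl

-- Pigeonhole, the counting step behind `small` and `large`. The offsets allow blocks to be compared
-- in place, without renumbering them.
injective⇒window-≤ : ∀ {f : ℕ → ℕ} → (∀ {i j} → f i ≡ f j → i ≡ j) → ∀ a b {m k} →
                     (∀ {i} → i < m → ∃[ j ] (j < k × f (a ℕ.+ i) ≡ b ℕ.+ j)) → m ≤ k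
injective⇒window-≤ {f} inj a b {m} {k} maps = injective⇒≤ {f = h} λ {i} {j} eq →
  toℕ-injective (+-cancelˡ-≡ a _ _ (inj (trans (eqn i)
    (trans (cong (λ i → b ℕ.+ toℕ i) eq) (sym (eqn j))))))
  where
  h : Fin m → Fin k
  h i = fromℕ< (proj₁ (proj₂ (maps (toℕ<n i))))
  eqn : ∀ i → f (a ℕ.+ toℕ i) ≡ b ℕ.+ toℕ (h i)
  eqn i = trans (proj₂ (proj₂ (maps (toℕ<n i)))) (cong (b ℕ.+_) (sym (toℕ-fromℕ< _)))

-- The plot of t, translated by (a , b), is contained in the graph of f.
record Matches (t : Tree) (f : ℕ → ℕ) (a b : ℕ) : Set where
  constructor matches
  field
    value : (p : Point t) → f (a ℕ.+ column p) ≡ b ℕ.+ row p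

+-suc-+ : ∀ a m {k} → a ℕ.+ suc (m ℕ.+ k) ≡ suc a ℕ.+ m ℕ.+ k
+-suc-+ a m {k} = trans (+-suc a _) (cong suc (sym (+-assoc a m k)))

module _ {f : ℕ → ℕ} {s t : Tree} {a b : ℕ} where

  matches-node : f a ≡ b ℕ.+ size s → Matches s f (suc a) b →
                 Matches t f (suc a ℕ.+ size s) (suc b ℕ.+ size s) → Matches (node s t) f a b
  matches-node h (matches l) (matches r) = matches λ where
    root      → trans (cong f (+-identityʳ a)) h
    (left p)  → trans (cong f (+-suc a _)) (l p)
    (right p) → trans (cong f (+-suc-+ a (size s))) (trans (r p) (sym (+-suc-+ b (size s))))

  matches-root : Matches (node s t) f a b → f a ≡ b ℕ.+ size s
  matches-root (matches m) = trans (cong f (sym (+-identityʳ a))) (m root)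

  matches-left : Matches (node s t) f a b → Matches s f (suc a) b
  matches-left (matches m) = matches λ p → trans (cong f (sym (+-suc a _))) (m (left p))

  matches-right : Matches (node s t) f a b → Matches t f (suc a ℕ.+ size s) (suc b ℕ.+ size s)
  matches-right (matches m) = matches λ p →
    trans (cong f (sym (+-suc-+ a (size s)))) (trans (m (right p)) (+-suc-+ b (size s)))

matches-cong : ∀ {f g t a b} → (∀ i → f i ≡ g i) → Matches t f a b → Matches t g a b
matches-cong f≗g (matches m) = matches λ p → trans (sym (f≗g _)) (m p)

-- The value in the first column determines the size of the first subtree, hence both windows to
-- recurse on.
matches-unique : ∀ {f} s t {a b} → size s ≡ size t → Matches s f a b → Matches t f a b → s ≡ t
matches-unique leaf       leaf         _ _ _  = refl
matches-unique {f} (node s t) (node s′ t′) {a} {b} e m m′ = cong₂ node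
  (matches-unique s s′ s≡s′ (matches-left m) (matches-left m′))
  (matches-unique t t′
    (+-cancelˡ-≡ (size s) _ _ (trans (suc-injective e) (cong (ℕ._+ size t′) (sym s≡s′))))
    (matches-right m)
    (subst (λ k → Matches t′ f (suc a ℕ.+ k) (suc b ℕ.+ k)) (sym s≡s′) (matches-right m′)))
  where
  s≡s′ : size s ≡ size s′
  s≡s′ = +-cancelˡ-≡ b _ _ (trans (sym (matches-root m)) (matches-root m′))

-- Parsing a 231-avoiding bijection into a tree

Avoids231 : (ℕ → ℕ) → Set
Avoids231 f = ∀ {i j k} → i < j → j < k → f k < f i → ¬ f i < f j

-- Assumed both for a function and, with the offsets interchanged, for its inverse, it says that the
-- function restricts to a bijection between the two windows.
MapsInto : (ℕ → ℕ) → ℕ → ℕ → ℕ → Set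
MapsInto f n a b = ∀ {i} → i < n → ∃[ j ] (j < n × f (a ℕ.+ i) ≡ b ℕ.+ j)

module _ {f g : ℕ → ℕ} (gf : ∀ i → g (f i) ≡ i) (fg : ∀ i → f (g i) ≡ i) (avoids : Avoids231 f) where

  private
    f-inj : ∀ {i j} → f i ≡ f j → i ≡ j
    f-inj {i} {j} eq = trans (sym (gf i)) (trans (cong g eq) (gf j))

    g-inj : ∀ {i j} → g i ≡ g j → i ≡ j
    g-inj {i} {j} eq = trans (sym (fg i)) (trans (cong f eq) (fg j))

  module Split {a b} k l (fw : MapsInto f (suc (k ℕ.+ l)) a b) (bw : MapsInto g (suc (k ℕ.+ l)) b a)
               (fa : f a ≡ b ℕ.+ k) where

    n : ℕ
    n = k ℕ.+ l

    k≤n : k ≤ n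
    k≤n = m≤m+n k l

    -- Positions are counted after the first entry, values from the bottom of the window. So `i < n`
    -- but `j ≤ n`, the value `k` being taken by the first entry.
    at : ℕ → ℕ → Set
    at i j = f (suc a ℕ.+ i) ≡ b ℕ.+ j

    fw′ : ∀ {i} → i < n → ∃[ j ] (j ≤ n × at i j)
    fw′ i<n with j , s≤s j≤n , e ← fw (s<s i<n) = j , j≤n , trans (cong f (sym (+-suc a _))) e

    at-functional : ∀ {i j j′} → at i j → at i j′ → j ≡ j′
    at-functional e e′ = +-cancelˡ-≡ b _ _ (trans (sym e) e′)

    at-≢k : ∀ {i j} → at i j → j ≢ k
    at-≢k e refl = m≢1+m+n a (f-inj (trans fa (sym e)))

    no-231-at : ∀ {i i′ j j′} → i < i′ → at i j → at i′ j′ → k < j → ¬ j′ < k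
    no-231-at i<i′ e e′ k<j j′<k = avoids {a} (s≤s (m≤m+n a _)) (s<s (+-monoʳ-< a i<i′))
      (subst₂ _<_ (sym e′) (sym fa) (+-monoʳ-< b j′<k)) (subst₂ _<_ (sym fa) (sym e) (+-monoʳ-< b k<j))

    bw′ : ∀ {j} → j ≤ n → j ≢ k → ∃[ i ] (i < n × at i j × g (b ℕ.+ j) ≡ suc a ℕ.+ i)
    bw′ {j} j≤n j≢k with bw (s≤s j≤n)
    ... | zero  , _       , e = contradiction
      (+-cancelˡ-≡ b _ _ (trans (sym (fg (b ℕ.+ j))) (trans (cong f (trans e (+-identityʳ a))) fa))) j≢k
    ... | suc i , s<s i<n , e = i , i<n , trans (cong f (sym e′)) (fg (b ℕ.+ j)) , e′
      where
      e′ = trans e (+-suc a i)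

    -- A large value before a small one would, with f a, form 231.  So if position
    -- i < k carried a value above k, all k values below k would sit in front of
    -- it; if a position i ≥ k carried a value below k, so would all positions
    -- before it, more than there are values below k.
    small : ∀ {i j} → i < k → at i j → j < k
    small {i} {j} i<k e with <-cmp j k
    ... | tri< j<k _ _ = j<k
    ... | tri≈ _ j≡k _ = contradiction j≡k (at-≢k e)
    ... | tri> _ _ k<j = contradiction i<k (≤⇒≯ (injective⇒window-≤ g-inj b (suc a) before))
      where
      before : ∀ {j′} → j′ < k → ∃[ i′ ] (i′ < i × g (b ℕ.+ j′) ≡ suc a ℕ.+ i′)
      before {j′} j′<k with i′ , _ , e′ , ge ← bw′ (≤-trans (<⇒≤ j′<k) k≤n) (<⇒≢ j′<k) with <-cmp i′ i
      ... | tri< i′<i _ _ = i′ , i′<i , ge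
      ... | tri≈ _ refl _ = contradiction (at-functional e e′) (>⇒≢ (<-trans j′<k k<j))
      ... | tri> _ _ i<i′ = contradiction j′<k (no-231-at i<i′ e e′ k<j)

    large : ∀ {i j} → i < n → k ≤ i → at i j → k < j
    large {i} {j} i<n k≤i e with <-cmp j k
    ... | tri> _ _ k<j = k<j
    ... | tri≈ _ j≡k _ = contradiction j≡k (at-≢k e)
    ... | tri< j<k _ _ = contradiction (injective⇒window-≤ f-inj (suc a) b below) (<⇒≱ (s≤s k≤i))
      where
      below : ∀ {i′} → i′ < suc i → ∃[ j′ ] (j′ < k × f (suc a ℕ.+ i′) ≡ b ℕ.+ j′)
      below {i′} (s≤s i′≤i) with j′ , _ , e′ ← fw′ (≤-<-trans i′≤i i<n) with <-cmp j′ k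
      ... | tri< j′<k _ _ = j′ , j′<k , e′
      ... | tri≈ _ j′≡k _ = contradiction j′≡k (at-≢k e′)
      ... | tri> _ _ k<j′ with m≤n⇒m<n∨m≡n i′≤i
      ...   | inj₁ i′<i = contradiction j<k (no-231-at i′<i e′ e k<j′)
      ...   | inj₂ refl = contradiction (at-functional e e′) (<⇒≢ (<-trans j<k k<j′))

    fwˡ : MapsInto f k (suc a) b
    fwˡ i<k with j , _ , e ← fw′ (≤-trans i<k k≤n) = j , small i<k e , e

    bwˡ : MapsInto g k b (suc a)
    bwˡ j<k with i , i<n , e , ge ← bw′ (≤-trans (<⇒≤ j<k) k≤n) (<⇒≢ j<k) =
      i , ≰⇒> (λ k≤i → <-asym j<k (large i<n k≤i e)) , ge

    -- The extra one in the column offset is the leading column of the root; in the row offset it is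
    -- the row of the root, which separates the two blocks.
    fwʳ : MapsInto f l (suc a ℕ.+ k) (suc b ℕ.+ k)
    fwʳ {i} i<l
      with j , j≤n , e ← fw′ (+-monoʳ-< k i<l)
      with j′ , refl ← m≤n⇒∃[o]m+o≡n (large (+-monoʳ-< k i<l) (m≤m+n k i) e) =
      j′ , +-cancelˡ-≤ k _ _ (subst (_≤ k ℕ.+ l) (sym (+-suc k j′)) j≤n) ,
      trans (cong f (+-assoc (suc a) k i)) (trans e (+-suc-+ b k))

    bwʳ : MapsInto g l (suc b ℕ.+ k) (suc a ℕ.+ k)
    bwʳ {j} j<l
      with i , i<n , e , ge ← bw′ {suc k ℕ.+ j} (+-monoʳ-< k j<l) (>⇒≢ (s≤s (m≤m+n k j)))
      with i′ , refl ← m≤n⇒∃[o]m+o≡n (≮⇒≥ λ i<k → <-asym (small i<k e) (s≤s (m≤m+n k j))) =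
      i′ , +-cancelˡ-< k _ _ i<n ,
      trans (cong g (sym (+-suc-+ b k))) (trans ge (sym (+-assoc (suc a) k i′)))

  -- The offsets stay quantified because the two recursive calls are made at different windows.
  Parsed : ℕ → Set
  Parsed n = ∀ {a b} → MapsInto f n a b → MapsInto g n b a →
             Σ[ t ∈ Tree ] (size t ≡ n × Matches t f a b)

  parse : ∀ n → Parsed n
  parse = <-rec Parsed step
    where
    step : ∀ n → (∀ {m} → m < n → Parsed m) → Parsed n
    step zero    _ _ _ = leaf , refl , matches λ ()
    step (suc n) rec {a} fw bw
      -- The relative value `k` of the first entry is the size of the first subtree.
      with k , s≤s k≤n , e ← fw z<s
      with l , refl ← m≤n⇒∃[o]m+o≡n k≤n
      with fa ← trans (cong f (sym (+-identityʳ a))) e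
      with s , refl , ms ← rec (s≤s k≤n) (Split.fwˡ k l fw bw fa) (Split.bwˡ k l fw bw fa)
         | t , refl , mt ← rec (s≤s (m≤n+m l k)) (Split.fwʳ k l fw bw fa) (Split.bwʳ k l fw bw fa)
      = node s t , refl , matches-node fa ms mt

-- Occurrences in a permutation and in its tree

StrictlyMonotone : ∀ {k n} → (Fin k → Fin n) → Set
StrictlyMonotone f = ∀ {i j} → i Fin.< j → f i Fin.< f j

strict⇒opi : ∀ {k n} {f : Fin k → Fin n} → StrictlyMonotone f → OrderPreservingInjection f
strict⇒opi {f = f} f-mono = record { mono = mono ; injective = inj }
  where
  mono : ∀ {i j} → i Fin.≤ j → f i Fin.≤ f j
  mono {i} {j} i≤j with Fin.<-cmp i j
  ... | tri< i<j _ _  = <⇒≤ (f-mono i<j)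
  ... | tri≈ _ refl _ = ≤-refl
  ... | tri> _ _ j<i  = contradiction i≤j (<⇒≱ j<i)
  inj : Injective _≡_ _≡_ f
  inj {i} {j} e with Fin.<-cmp i j
  ... | tri< i<j _ _ = contradiction (f-mono i<j) (<-irrefl (cong toℕ e))
  ... | tri≈ _ eq _  = eq
  ... | tri> _ _ j<i = contradiction (f-mono j<i) (<-irrefl (cong toℕ (sym e)))

opi⇒strict : ∀ {k n} {f : Fin k → Fin n} → OrderPreservingInjection f → StrictlyMonotone f
opi⇒strict opi i<j = ≤∧≢⇒< (mono (<⇒≤ i<j)) λ e → <-irrefl (cong toℕ (injective (toℕ-injective e))) i<j
  where open OrderPreservingInjection opi

pick-strict : ∀ {n} {i j : Fin n} → i Fin.< j → StrictlyMonotone (pick i j)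
pick-strict i<j {0F} {1F} _ = i<j
pick-strict i<j {1F} {1F} (s<s ())

module _ {A : Set} {_≺_ : A → A → Set} {n} (f : A → Fin n) {α : Fin 2 → Fin n} {a b r : A}
         (fa : f a ≡ α 0F) (fb : f b ≡ α 1F) where

  strip⇒between : (∀ {p q} → p ≺ q → f p Fin.< f q) → ∀ i → Strip _≺_ a b i r → Between α i (f r)
  strip⇒between mono 0F l       = z<s , s<s (subst (f r Fin.<_) fa (mono l))
  strip⇒between mono 1F (l , u) =
    s<s (subst (Fin._< f r) fa (mono l)) , s<s (subst (f r Fin.<_) fb (mono u))
  strip⇒between mono 2F l       = s<s (subst (Fin._< f r) fb (mono l)) , s<s (toℕ<n (f r))

  between⇒strip : (∀ {p q} → f p Fin.< f q → p ≺ q) → ∀ i → Between α i (f r) → Strip _≺_ a b i r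
  between⇒strip cancel 0F (_ , s<s l)     = cancel (subst (f r Fin.<_) (sym fa) l)
  between⇒strip cancel 1F (s<s l , s<s u) =
    cancel (subst (Fin._< f r) (sym fa) l) , cancel (subst (f r Fin.<_) (sym fb) u)
  between⇒strip cancel 2F (s<s l , _)     = cancel (subst (Fin._< f r) (sym fb) l)

toPermutation-matches : ∀ t → Matches t (extendℕ (toPermutation t ⟨$⟩ʳ_)) 0 0
toPermutation-matches t = matches λ p → trans (extendℕ-< _ (column<size p)) (trans
  (cong (toℕ ∘ Inverse.to (Rʸ.rank t)) (Inverse.strictlyInverseʳ (Rˣ.rank t) p))
  (toℕ-fromℕ< (row<size p)))

module Plot {t : Tree} (π : Permutation′ (size t)) (m : Matches t (extendℕ (π ⟨$⟩ʳ_)) 0 0) where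

  open Rˣ t using () renaming (rank to rankˣ; f-cancel to column-cancel)
  open Rʸ t using () renaming (f-cancel to row-cancel)

  position value : Point t → Fin (size t)
  position = Inverse.to rankˣ
  value p  = π ⟨$⟩ʳ position p

  point : Fin (size t) → Point t
  point = Inverse.from rankˣ

  position-point : ∀ i → position (point i) ≡ i
  position-point = Inverse.strictlyInverseˡ rankˣ

  value-point : ∀ i → value (point i) ≡ π ⟨$⟩ʳ i
  value-point i = cong (π ⟨$⟩ʳ_) (position-point i)

  toℕ-position : ∀ p → toℕ (position p) ≡ column p
  toℕ-position p = toℕ-fromℕ< (column<size p)

  toℕ-value : ∀ p → toℕ (value p) ≡ row p
  toℕ-value p = trans (sym (extendℕ-< _ (column<size p))) (Matches.value m p)

  position-mono : ∀ {p q} → p <ˣ q → position p Fin.< position q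
  position-mono l = subst₂ _<_ (sym (toℕ-position _)) (sym (toℕ-position _)) (column-mono l)

  position-cancel : ∀ {p q} → position p Fin.< position q → p <ˣ q
  position-cancel l = column-cancel (subst₂ _<_ (toℕ-position _) (toℕ-position _) l)

  value-mono : ∀ {p q} → p <ʸ q → value p Fin.< value q
  value-mono l = subst₂ _<_ (sym (toℕ-value _)) (sym (toℕ-value _)) (row-mono l)

  value-cancel : ∀ {p q} → value p Fin.< value q → p <ʸ q
  value-cancel l = row-cancel (subst₂ _<_ (toℕ-value _) (toℕ-value _) l)

  module _ {k} {τ : Permutation′ k} {R} {ω} (o : IsOccurrence (mesh τ R) π ω) where

    open IsOccurrence o

    π∘α : ∀ i → π ⟨$⟩ʳ α i ≡ β (τ ⟨$⟩ʳ i)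
    π∘α i = ω⊆G (proj₂ image (i , τ ⟨$⟩ʳ i , refl , refl , refl))

    value-at : ∀ j → value (point (α (τ ⟨$⟩ˡ j))) ≡ β j
    value-at j = trans (value-point _) (trans (π∘α _) (cong β (inverseʳ τ)))

    points-<ˣ : ∀ {i j} → i Fin.< j → point (α i) <ˣ point (α j)
    points-<ˣ i<j = position-cancel
      (subst₂ Fin._<_ (sym (position-point _)) (sym (position-point _)) (opi⇒strict α-opi i<j))

    points-<ʸ : ∀ {i j} → i Fin.< j → point (α (τ ⟨$⟩ˡ i)) <ʸ point (α (τ ⟨$⟩ˡ j))
    points-<ʸ i<j = value-cancel
      (subst₂ Fin._<_ (sym (value-at _)) (sym (value-at _)) (opi⇒strict β-opi i<j))

  avoids-231 : Avoids π (classical π₂₃₁)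
  avoids-231 ω o = no-231 (points-<ˣ o {0F} {1F} z<s) (points-<ˣ o {1F} {2F} (s<s z<s))
    (points-<ʸ o {0F} {1F} z<s) (points-<ʸ o {1F} {2F} (s<s z<s))

  module _ {τ : Permutation′ 2} {R : List (Fin 3 × Fin 3)} where

    occurrence⇒occurs : ∀ {ω} → IsOccurrence (mesh τ R) π ω → Occurs τ R t
    occurrence⇒occurs o = occurs (pick-η (τ ⟨$⟩ˡ 0F)) (pick-η (τ ⟨$⟩ˡ 1F))
      (points-<ˣ o {0F} {1F} z<s) (points-<ʸ o {0F} {1F} z<s)
      (All.tabulate λ { {i , j} c∈R r u v → empty c∈R (position r , value r)
        ( ( strip⇒between position {α} (position-point _) (position-point _) position-mono i u
          , strip⇒between value {β} (value-at o 0F) (value-at o 1F) value-mono j v)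
        , refl) })
      where
      open IsOccurrence o
      pick-η : ∀ j → point (α j) ≡ pick (point (α 0F)) (point (α 1F)) j
      pick-η 0F = refl
      pick-η 1F = refl

    occurs⇒occurrence : Occurs τ R t → ∃[ ω ] IsOccurrence (mesh τ R) π ω
    occurs⇒occurrence (occurs {p} {q} refl refl p<q lo<hi cs) = _ , record
      { ω⊆G   = λ { (i , _ , refl , refl , refl) → π∘positions i }
      ; α     = positions
      ; β     = values
      ; α-opi = strict⇒opi (pick-strict (position-mono p<q))
      ; β-opi = strict⇒opi (pick-strict (value-mono lo<hi))
      ; image = id , id
      ; empty = empty
      }
      where
      at : Fin 2 → Point t
      at j = pick p q (τ ⟨$⟩ˡ j)
      positions values : Fin 2 → Fin (size t)
      positions = pick (position p) (position q)
      values = pick (value (at 0F)) (value (at 1F))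

      π∘positions : ∀ i → π ⟨$⟩ʳ positions i ≡ values (τ ⟨$⟩ʳ i)
      π∘positions i = trans (cong (π ⟨$⟩ʳ_) (sym (pick-map position i)))
        (trans (cong (λ i → value (pick p q i)) (sym (inverseˡ τ))) (values-at (τ ⟨$⟩ʳ i)))
        where
        values-at : ∀ j → value (at j) ≡ values j
        values-at 0F = refl
        values-at 1F = refl

      empty : ∀ {c} → c ∈ᴸ R → Empty (Region positions values c ∩ G π)
      empty {i , j} c∈R (h , .(π ⟨$⟩ʳ h)) ((u , v) , refl) = All.lookup cs c∈R (point h)
        (between⇒strip position {positions} refl refl position-cancel i
          (subst (Between positions i) (sym (position-point h)) u))
        (between⇒strip value {values} refl refl value-cancel j
          (subst (Between values j) (sym (value-point h)) v))

occurrence-231 : ∀ {n} (π : Permutation′ n) {i j k} → i Fin.< j → j Fin.< k →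
                 π ⟨$⟩ʳ k Fin.< π ⟨$⟩ʳ i → π ⟨$⟩ʳ i Fin.< π ⟨$⟩ʳ j →
                 ∃[ ω ] IsOccurrence (classical π₂₃₁) π ω
occurrence-231 π {i} {j} {k} i<j j<k πk<πi πi<πj = _ , record
  { ω⊆G   = λ { (0F , _ , refl , refl , refl) → refl
              ; (1F , _ , refl , refl , refl) → refl
              ; (2F , _ , refl , refl , refl) → refl }
  ; α     = pick₃ i j k
  ; β     = pick₃ (π ⟨$⟩ʳ k) (π ⟨$⟩ʳ i) (π ⟨$⟩ʳ j)
  ; α-opi = strict⇒opi (pick₃-strict i<j j<k)
  ; β-opi = strict⇒opi (pick₃-strict πk<πi πi<πj)
  ; image = id , id
  ; empty = λ ()
  }
  where
  pick₃ : ∀ {A : Set} → A → A → A → Fin 3 → A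
  pick₃ a b c 0F      = a
  pick₃ a b c (suc i) = pick b c i

  pick₃-strict : ∀ {n} {a b c : Fin n} → a Fin.< b → b Fin.< c → StrictlyMonotone (pick₃ a b c)
  pick₃-strict a<b b<c {0F}    {1F}    _       = a<b
  pick₃-strict a<b b<c {0F}    {2F}    _       = <-trans a<b b<c
  pick₃-strict a<b b<c {suc i} {suc j} (s<s l) = pick-strict b<c l

-- Only triples with `k ≥ n` are new. There `f k = k`, which exceeds `f i`: it is at least `n` if
-- `i < n`, and otherwise `f i = i < k`.
avoids⇒Avoids231 : ∀ {n} (π : Permutation′ n) → Avoids π (classical π₂₃₁) → Avoids231 (extendℕ (π ⟨$⟩ʳ_))
avoids⇒Avoids231 {n} π av {i} {j} {k} i<j j<k fk<fi fi<fj = by-cases (k <? n) (i <? n)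
  where
  f : Fin n → Fin n
  f = π ⟨$⟩ʳ_

  fromℕ<-mono : ∀ {i j} (i<n : i < n) (j<n : j < n) → i < j → fromℕ< i<n Fin.< fromℕ< j<n
  fromℕ<-mono i<n j<n = subst₂ _<_ (sym (toℕ-fromℕ< i<n)) (sym (toℕ-fromℕ< j<n))

  by-cases : Dec (k < n) → Dec (i < n) → ⊥
  by-cases (yes k<n) _ = uncurry av (occurrence-231 π
    (fromℕ<-mono i<n j<n i<j) (fromℕ<-mono j<n k<n j<k)
    (subst₂ _<_ (extendℕ-< f k<n) (extendℕ-< f i<n) fk<fi)
    (subst₂ _<_ (extendℕ-< f i<n) (extendℕ-< f j<n) fi<fj))
    where
    j<n = <-trans j<k k<n
    i<n = <-trans i<j j<n
  by-cases (no k≮n) (yes i<n) =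
    k≮n (<-trans (subst₂ _<_ (extendℕ-≮ f k≮n) (extendℕ-< f i<n) fk<fi) (toℕ<n _))
  by-cases (no k≮n) (no i≮n) =
    <-asym (subst₂ _<_ (extendℕ-≮ f k≮n) (extendℕ-≮ f i≮n) fk<fi) (<-trans i<j j<k)

extendℕ-maps : ∀ {n} (f : Fin n → Fin n) → MapsInto (extendℕ f) n 0 0
extendℕ-maps f i<n = _ , toℕ<n _ , extendℕ-< f i<n

toTree : ∀ {n} (π : Permutation′ n) → Avoids π (classical π₂₃₁) →
         Σ[ t ∈ Tree ] (size t ≡ n × Matches t (extendℕ (π ⟨$⟩ʳ_)) 0 0)
toTree {n} π av = parse (extendℕ-inverse (π ⟨$⟩ʳ_) (π ⟨$⟩ˡ_) (λ _ → inverseˡ π))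
  (extendℕ-inverse (π ⟨$⟩ˡ_) (π ⟨$⟩ʳ_) (λ _ → inverseʳ π))
  (avoids⇒Avoids231 π av) n (extendℕ-maps _) (extendℕ-maps _)

matches-determines : ∀ {t} (π ρ : Permutation′ (size t)) → Matches t (extendℕ (π ⟨$⟩ʳ_)) 0 0 →
                     Matches t (extendℕ (ρ ⟨$⟩ʳ_)) 0 0 → ∀ i → π ⟨$⟩ʳ i ≡ ρ ⟨$⟩ʳ i
matches-determines π ρ m m′ i = toℕ-injective (trans (cong toℕ (sym (Plot.value-point π m i)))
  (trans (Plot.toℕ-value π m _) (trans (sym (Plot.toℕ-value ρ m′ _))
    (cong toℕ (Plot.value-point ρ m′ i)))))

-- Avoiders as classes of trees

Class : (Tree → Bool) → ℕ → Set
Class P n = Σ[ t ∈ Tree ] (size t ≡ n × P t ≡ true)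

class-≡ : ∀ {P n} {u v : Class P n} → proj₁ u ≡ proj₁ v → u ≡ v
class-≡ {u = t , e , p} {v = .t , e′ , p′} refl =
  cong₂ (λ e p → t , e , p) (≡-irrelevant e e′) (Decidable⇒UIP.≡-irrelevant Bool._≟_ p p′)

module _ {τ : Permutation′ 2} {R : List (Fin 3 × Fin 3)} {P : Tree → Bool}
         (sound : ∀ t → P t ≡ false → Occurs τ R t)
         (complete : ∀ t → P t ≡ true → ¬ Occurs τ R t) where

  Av↔Class : ∀ n → Inverse (Av n (classical π₂₃₁ ∷ mesh τ R ∷ [])) (setoid (Class P n))
  Av↔Class n = record
    { to        = to
    ; from      = from
    ; to-cong   = λ {a} {b} a≈b →
        to-unique a (to b) (matches-cong (extendℕ-cong (sym ∘ a≈b)) (to-matches b))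
    ; from-cong = λ { refl _ → refl }
    ; inverse   =
        (λ {u} {a} a≈u → to-unique a u (matches-cong (extendℕ-cong (sym ∘ a≈u)) (from-matches u))) ,
        (λ { {a} refl → from-to a })
    }
    where
    Avoider : Set₁
    Avoider = Setoid.Carrier (Av n (classical π₂₃₁ ∷ mesh τ R ∷ []))

    lift : Avoider → ℕ → ℕ
    lift (π , _) = extendℕ (π ⟨$⟩ʳ_)

    to-true : ∀ {t} (π : Permutation′ n) → size t ≡ n → Matches t (extendℕ (π ⟨$⟩ʳ_)) 0 0 →
              Avoids π (mesh τ R) → P t ≡ true
    to-true {t} π refl m av = ¬-not λ e → uncurry av (Plot.occurs⇒occurrence π m (sound t e))

    to : Avoider → Class P n
    to (π , av₂₃₁ ∷ av ∷ []) with t , e , m ← toTree π av₂₃₁ = t , e , to-true π e m av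

    to-matches : ∀ a → Matches (proj₁ (to a)) (lift a) 0 0
    to-matches (π , av₂₃₁ ∷ av ∷ []) = proj₂ (proj₂ (toTree π av₂₃₁))

    -- Uniqueness of the matching tree gives both that `to` respects pointwise equality and one of
    -- the inverse laws.
    to-unique : ∀ a (u : Class P n) → Matches (proj₁ u) (lift a) 0 0 → to a ≡ u
    to-unique a u m = class-≡ (matches-unique _ _
      (trans (proj₁ (proj₂ (to a))) (sym (proj₁ (proj₂ u)))) (to-matches a) m)

    from : Class P n → Avoider
    from (t , refl , Pt) = toPermutation t
      , avoids-231 ∷ (λ _ o → complete t Pt (occurrence⇒occurs o)) ∷ []
      where open Plot (toPermutation t) (toPermutation-matches t)

    from-matches : ∀ u → Matches (proj₁ u) (lift (from u)) 0 0
    from-matches (t , refl , _) = toPermutation-matches t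

    -- Stated for arbitrary `u` so that its size equation can be matched with `refl`.
    from-determined : ∀ u a → Matches (proj₁ u) (lift a) 0 0 →
                      ∀ i → proj₁ (from u) ⟨$⟩ʳ i ≡ proj₁ a ⟨$⟩ʳ i
    from-determined (t , refl , _) (π , _) m =
      matches-determines (toPermutation t) π (toPermutation-matches t) m

    from-to : ∀ a i → proj₁ (from (to a)) ⟨$⟩ʳ i ≡ proj₁ a ⟨$⟩ʳ i
    from-to a = from-determined (to a) a (to-matches a)

-- Counting

infixl 7 _*ᴺ_

_*ᴺ_ : (ℕ → ℕ) → (ℕ → ℕ) → ℕ → ℕ
(f *ᴺ g) n = ℕΣ.sum {suc n} (λ i → f (toℕ i) ℕ.* g (n ∸ toℕ i))

Finite : Set → Set
Finite A = ∃[ n ] A ↔ Fin n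

Σ-Fin-suc : ∀ {n} (F : Fin (suc n) → Set) →
            (Σ[ i ∈ Fin (suc n) ] F i) ↔ (F zero ⊎ (Σ[ i ∈ Fin n ] F (suc i)))
Σ-Fin-suc F = mk↔ₛ′
  (λ { (zero , a) → inj₁ a ; (suc i , a) → inj₂ (i , a) })
  (λ { (inj₁ a) → zero , a ; (inj₂ (i , a)) → suc i , a })
  (λ { (inj₁ _) → refl ; (inj₂ _) → refl })
  (λ { (zero , _) → refl ; (suc _ , _) → refl })

Σ-Fin↔ : ∀ {n} {F : Fin n → Set} {c : Fin n → ℕ} →
         (∀ i → F i ↔ Fin (c i)) → (Σ[ i ∈ Fin n ] F i) ↔ Fin (ℕΣ.sum c)
Σ-Fin↔ {zero}  f = mk↔ₛ′ (λ ()) (λ ()) (λ ()) (λ ())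
Σ-Fin↔ {suc n} f = ↔-sym +↔⊎ ↔-∘ ((f zero ⊎-↔ Σ-Fin↔ (f ∘ suc)) ↔-∘ Σ-Fin-suc _)

Pairs : (Q R : Tree → Bool) → ℕ → Set
Pairs Q R n = Σ[ st ∈ Tree × Tree ]
  (size (proj₁ st) ℕ.+ size (proj₂ st) ≡ n × Q (proj₁ st) ∧ R (proj₂ st) ≡ true)

pairs-≡ : ∀ {Q R n} {u v : Pairs Q R n} → proj₁ u ≡ proj₁ v → u ≡ v
pairs-≡ {u = st , e , p} {v = .st , e′ , p′} refl =
  cong₂ (λ e p → st , e , p) (≡-irrelevant e e′) (Decidable⇒UIP.≡-irrelevant Bool._≟_ p p′)

module _ {Q R : Tree → Bool} {n : ℕ} where

  private
    Classes : Set
    Classes = Σ[ i ∈ Fin (suc n) ] (Class Q (toℕ i) × Class R (n ∸ toℕ i))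

  Pairs↔Classes : Pairs Q R n ↔ Classes
  Pairs↔Classes = mk↔ₛ′ to from to-from (λ u → pairs-≡ {Q} {R} {v = u} refl)
    where
    to : Pairs Q R n → Classes
    to ((s , t) , e , q∧r) = fromℕ< s<1+n
      , (s , sym toℕ-i , proj₁ (∧-true q∧r))
      , (t , trans (sym (m+n∸m≡n (size s) (size t))) (cong₂ _∸_ e (sym toℕ-i)) , proj₂ (∧-true q∧r))
      where
      s<1+n : size s < suc n
      s<1+n = s≤s (subst (size s ≤_) e (m≤m+n _ _))
      toℕ-i = toℕ-fromℕ< s<1+n

    from : Classes → Pairs Q R n
    from (i , (s , e , q) , (t , e′ , r)) = (s , t)
      , trans (cong₂ ℕ._+_ e e′) (m+[n∸m]≡n (≤-pred (toℕ<n i)))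
      , cong₂ _∧_ q r

    classes-≡ : {u v : Classes} → toℕ (proj₁ u) ≡ toℕ (proj₁ v) →
                proj₁ (proj₁ (proj₂ u)) ≡ proj₁ (proj₁ (proj₂ v)) →
                proj₁ (proj₂ (proj₂ u)) ≡ proj₁ (proj₂ (proj₂ v)) → u ≡ v
    classes-≡ {i , _} {j , _} i≡j s t with refl ← toℕ-injective i≡j =
      cong (i ,_) (cong₂ _,_ (class-≡ s) (class-≡ t))

    to-from : ∀ v → to (from v) ≡ v
    to-from (i , (s , e , q) , (t , e′ , r)) = classes-≡ (trans (toℕ-fromℕ< _) e) refl refl

  count-pairs : {q r : Fin (suc n) → ℕ} → (∀ i → Class Q (toℕ i) ↔ Fin (q i)) →
                (∀ i → Class R (n ∸ toℕ i) ↔ Fin (r i)) → Pairs Q R n ↔ Fin (ℕΣ.sum (λ i → q i ℕ.* r i))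
  count-pairs Q↔ R↔ = Σ-Fin↔ (λ i → ↔-sym *↔× ↔-∘ (Q↔ i ×-↔ R↔ i)) ↔-∘ Pairs↔Classes

-- P at a node amounts to Q and R at the two subtrees, once these have been
-- rearranged by θ.
record Decomposition (P Q R : Tree → Bool) : Set where
  field
    θ : (Tree × Tree) ↔ (Tree × Tree)
  open Inverse θ using (to; from; strictlyInverseˡ; strictlyInverseʳ)
  field
    θ-size : ∀ s t → size (proj₁ (to (s , t))) ℕ.+ size (proj₂ (to (s , t))) ≡ size s ℕ.+ size t
    θ-true : ∀ s t → P (node s t) ≡ Q (proj₁ (to (s , t))) ∧ R (proj₂ (to (s , t)))

  Class↔Pairs : ∀ n → Class P (suc n) ↔ Pairs Q R n
  Class↔Pairs n = mk↔ₛ′ f g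
    (λ v → pairs-≡ {Q} {R} (strictlyInverseˡ (proj₁ v)))
    (λ { (node s t , _ , _) →
           class-≡ (cong (λ st → node (proj₁ st) (proj₂ st)) (strictlyInverseʳ (s , t))) })
    where
    f : Class P (suc n) → Pairs Q R n
    f (node s t , e , p) = to (s , t) , trans (θ-size s t) (suc-injective e) , trans (sym (θ-true s t)) p
    g : Pairs Q R n → Class P (suc n)
    g (uv , e , qr) = node s t
      , cong suc (trans (sym (θ-size s t)) (trans (cong total (strictlyInverseˡ uv)) e))
      , trans (θ-true s t) (trans (cong (λ uv → Q (proj₁ uv) ∧ R (proj₂ uv)) (strictlyInverseˡ uv)) qr)
      where
      s = proj₁ (from uv)
      t = proj₂ (from uv)
      total : Tree × Tree → ℕ
      total (u , v) = size u ℕ.+ size v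

  -- The bounded hypotheses let `Q` or `R` be `P` itself inside a well-founded recursion.
  finite-suc : ∀ n → (∀ {i} → i < suc n → Finite (Class Q i)) →
               (∀ {i} → i < suc n → Finite (Class R i)) → Finite (Class P (suc n))
  finite-suc n Q-finite R-finite = _ , count-pairs
    (λ i → proj₂ (Q-finite (toℕ<n i))) (λ i → proj₂ (R-finite (s≤s (m∸n≤m n (toℕ i))))) ↔-∘ Class↔Pairs n

AllFinite : (Tree → Bool) → Set
AllFinite P = ∀ n → Finite (Class P n)

card : ∀ {P} → AllFinite P → ℕ → ℕ
card P-finite n = proj₁ (P-finite n)

module _ {P Q R} (d : Decomposition P Q R)
         (P-finite : AllFinite P) (Q-finite : AllFinite Q) (R-finite : AllFinite R) where

  -- Bijective finite sets have equal cardinality, so the recurrence follows without unfolding how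
  -- the finiteness witnesses were built.
  card-suc : ∀ n → card P-finite (suc n) ≡ (card Q-finite *ᴺ card R-finite) n
  card-suc n = ↔⇒≡ (count-pairs (proj₂ ∘ Q-finite ∘ toℕ) (λ i → proj₂ (R-finite (n ∸ toℕ i)))
    ↔-∘ (Decomposition.Class↔Pairs d n ↔-∘ ↔-sym (proj₂ (P-finite (suc n)))))

class-zero : ∀ P → Finite (Class P 0)
class-zero P with P leaf in eq
... | true  = 1 , mk↔ₛ′ (λ _ → zero) (λ _ → leaf , refl , eq)
                        (λ { zero → refl }) (λ { (leaf , _) → class-≡ refl })
... | false = 0 , mk↔ₛ′ (⊥-elim ∘ empty) (λ ()) (λ ()) (⊥-elim ∘ empty)
  where
  empty : Class P 0 → ⊥
  empty (leaf , _ , p) with () ← trans (sym eq) p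

-- The decompositions behind C, C - 1, M and P

everything : Tree → Bool
everything _ = true

everything-decomposition : Decomposition everything everything everything
everything-decomposition = record { θ = ↔-id _ ; θ-size = λ _ _ → refl ; θ-true = λ _ _ → refl }

nonleaf-decomposition : Decomposition nonleaf everything everything
nonleaf-decomposition = record { θ = ↔-id _ ; θ-size = λ _ _ → refl ; θ-true = λ _ _ → refl }

μ-decomposition : Decomposition μ everything nonleaf
μ-decomposition = record { θ = ↔-id _ ; θ-size = λ _ _ → refl ; θ-true = λ _ _ → refl }

mirror-involutive : ∀ t → mirror (mirror t) ≡ t
mirror-involutive leaf       = refl
mirror-involutive (node _ _) = refl

size-mirror : ∀ t → size (mirror t) ≡ size t
size-mirror leaf       = refl
size-mirror (node s t) = cong suc (+-comm (size t) (size s))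

mirror-↔ : Tree ↔ Tree
mirror-↔ = mk↔ₛ′ mirror mirror mirror-involutive mirror-involutive

swap-↔ : {A B : Set} → (A × B) ↔ (B × A)
swap-↔ = mk↔ₛ′ swap swap (λ _ → refl) (λ _ → refl)

-- This is t ⊕ (1 ⊖ r) in the original form; iterating it in `consForm` undoes `snocForm`.
postpend : Tree → Tree → Tree
postpend leaf       r = node r leaf
postpend (node s t) r = node s (postpend t r)

consForm : Tree → Tree
consForm leaf       = leaf
consForm (node l r) = postpend (consForm l) r

snocForm-postpend : ∀ t r → snocForm (postpend t r) ≡ node (snocForm t) r
snocForm-postpend leaf       r = refl
snocForm-postpend (node s t) r = cong (prepend s) (snocForm-postpend t r)

consForm-prepend : ∀ s t → consForm (prepend s t) ≡ node s (consForm t)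
consForm-prepend s leaf       = refl
consForm-prepend s (node l r) = cong (λ t → postpend t r) (consForm-prepend s l)

snocForm-consForm : ∀ t → snocForm (consForm t) ≡ t
snocForm-consForm leaf       = refl
snocForm-consForm (node l r) =
  trans (snocForm-postpend (consForm l) r) (cong (λ t → node t r) (snocForm-consForm l))

consForm-snocForm : ∀ t → consForm (snocForm t) ≡ t
consForm-snocForm leaf       = refl
consForm-snocForm (node s t) =
  trans (consForm-prepend s (snocForm t)) (cong (node s) (consForm-snocForm t))

size-prepend : ∀ s t → size (prepend s t) ≡ suc (size s ℕ.+ size t)
size-prepend s leaf       = cong suc (sym (+-identityʳ (size s)))
size-prepend s (node l r) = cong suc (trans (cong (ℕ._+ size r) (size-prepend s l))
  (trans (cong suc (+-assoc (size s) (size l) (size r))) (sym (+-suc (size s) _))))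

size-snocForm : ∀ t → size (snocForm t) ≡ size t
size-snocForm leaf       = refl
size-snocForm (node s t) =
  trans (size-prepend s (snocForm t)) (cong (λ n → suc (size s ℕ.+ n)) (size-snocForm t))

size-consForm : ∀ t → size (consForm t) ≡ size t
size-consForm t = trans (sym (size-snocForm (consForm t))) (cong size (snocForm-consForm t))

snocForm-↔ : Tree ↔ Tree
snocForm-↔ = mk↔ₛ′ snocForm consForm snocForm-consForm consForm-snocForm

-- For trees in snoc form: appendOnes i t is t ⊕ 1 ⊕ ⋯ ⊕ 1 with i summands 1, and
-- every tree is appendOnes i of its core for exactly one i.
appendOnes : ℕ → Tree → Tree
appendOnes zero    t = t
appendOnes (suc i) t = node (appendOnes i t) leaf

trailing : Tree → ℕ
trailing (node t leaf) = suc (trailing t)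
trailing _             = 0

core : Tree → Tree
core (node t leaf) = core t
core t             = t

appendOnes-core : ∀ t → appendOnes (trailing t) (core t) ≡ t
appendOnes-core leaf                  = refl
appendOnes-core (node t leaf)         = cong (λ t → node t leaf) (appendOnes-core t)
appendOnes-core (node _ (node _ _))   = refl

trailing-appendOnes : ∀ i t → trailing (appendOnes i (core t)) ≡ i
trailing-appendOnes (suc i) t                   = cong suc (trailing-appendOnes i t)
trailing-appendOnes zero    leaf                = refl
trailing-appendOnes zero    (node t leaf)       = trailing-appendOnes zero t
trailing-appendOnes zero    (node _ (node _ _)) = refl

core-appendOnes : ∀ i t → core (appendOnes i (core t)) ≡ core t
core-appendOnes (suc i) t                   = core-appendOnes i t
core-appendOnes zero    leaf                = refl
core-appendOnes zero    (node t leaf)       = core-appendOnes zero t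
core-appendOnes zero    (node _ (node _ _)) = refl

size-appendOnes : ∀ i t → size (appendOnes i t) ≡ i ℕ.+ size t
size-appendOnes zero    t = refl
size-appendOnes (suc i) t = cong suc (trans (+-identityʳ _) (size-appendOnes i t))

-- Acts on snoc forms: the cores stay and the numbers of trailing summands 1 are swapped.
exchange : Tree × Tree → Tree × Tree
exchange (s , t) = appendOnes (trailing t) (core s) , appendOnes (trailing s) (core t)

exchange-involutive : ∀ st → exchange (exchange st) ≡ st
exchange-involutive (s , t) = cong₂ _,_
  (trans (cong₂ appendOnes (trailing-appendOnes (trailing s) t) (core-appendOnes (trailing t) s))
         (appendOnes-core s))
  (trans (cong₂ appendOnes (trailing-appendOnes (trailing t) s) (core-appendOnes (trailing s) t))
         (appendOnes-core t))

size-exchange : ∀ s t → let u , v = exchange (s , t) in size u ℕ.+ size v ≡ size s ℕ.+ size t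
size-exchange s t = begin
  size (appendOnes j (core s)) ℕ.+ size (appendOnes i (core t))
    ≡⟨ cong₂ ℕ._+_ (size-appendOnes j _) (size-appendOnes i _) ⟩
  (j ℕ.+ size (core s)) ℕ.+ (i ℕ.+ size (core t))
    ≡⟨ solve 4 (λ j s i t → (j :+ s) :+ (i :+ t) := (i :+ s) :+ (j :+ t)) refl
         j (size (core s)) i (size (core t)) ⟩
  (i ℕ.+ size (core s)) ℕ.+ (j ℕ.+ size (core t))
    ≡⟨ cong₂ ℕ._+_ (size-appendOnes i _) (size-appendOnes j _) ⟨
  size (appendOnes i (core s)) ℕ.+ size (appendOnes j (core t))
    ≡⟨ cong₂ (λ s t → size s ℕ.+ size t) (appendOnes-core s) (appendOnes-core t) ⟩
  size s ℕ.+ size t ∎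
  where
  open +-*-Solver
  i = trailing s
  j = trailing t

μ-core : ∀ t → μ (core t) ≡ true
μ-core leaf                = refl
μ-core (node t leaf)       = μ-core t
μ-core (node _ (node _ _)) = refl

-- In snoc form `μ` only tests whether the number of trailing summands 1 is zero.
μ-appendOnes : ∀ s t → μ (appendOnes (trailing s) (core t)) ≡ μ s
μ-appendOnes leaf                t = μ-core t
μ-appendOnes (node _ leaf)       t = refl
μ-appendOnes (node _ (node _ _)) t = μ-core t

-- The condition for m₂ inspects only the first block, which a final 1 does not touch; if `t` is
-- empty the result is a single point.
avoids-postpend-leaf : ∀ t → avoids 1F (postpend t leaf) ≡ avoids 1F t
avoids-postpend-leaf leaf       = refl
avoids-postpend-leaf (node _ _) = refl

avoids-appendOnes : ∀ i t → avoids 1F (consForm (appendOnes i t)) ≡ avoids 1F (consForm t)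
avoids-appendOnes zero    t = refl
avoids-appendOnes (suc i) t =
  trans (avoids-postpend-leaf (consForm (appendOnes i t))) (avoids-appendOnes i t)

avoids-decomposition : ∀ i → Decomposition (avoids i) (avoids i) μ
avoids-decomposition 0F = record
  { θ      = ↔-id _ ×-↔ mirror-↔
  ; θ-size = λ s t → cong (size s ℕ.+_) (size-mirror t)
  ; θ-true = λ _ _ → refl
  }
avoids-decomposition 1F = record
  -- The first component returns to the original form, on which `avoids` recurses; the second stays
  -- in snoc form, where `μ` reads the last block.
  { θ      = (↔-sym snocForm-↔ ×-↔ ↔-id _) ↔-∘
             (mk↔ₛ′ exchange exchange exchange-involutive exchange-involutive ↔-∘
             (snocForm-↔ ×-↔ snocForm-↔))
  ; θ-size = λ s t →
      trans (cong (ℕ._+ size (proj₂ (exchange (snocForm s , snocForm t)))) (size-consForm _))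
        (trans (size-exchange (snocForm s) (snocForm t)) (cong₂ ℕ._+_ (size-snocForm s) (size-snocForm t)))
  ; θ-true = λ s t →
      cong₂ _∧_ (avoids-core s (trailing (snocForm t))) (sym (μ-appendOnes (snocForm s) (snocForm t)))
  }
  where
  avoids-core : ∀ s i → avoids 1F s ≡ avoids 1F (consForm (appendOnes i (core (snocForm s))))
  avoids-core s i = begin
    avoids 1F s                                              ≡⟨ cong (avoids 1F) (consForm-snocForm s) ⟨
    avoids 1F (consForm S)                                   ≡⟨ cong (avoids 1F ∘ consForm) (appendOnes-core S) ⟨
    avoids 1F (consForm (appendOnes (trailing S) (core S)))  ≡⟨ avoids-appendOnes (trailing S) (core S) ⟩
    avoids 1F (consForm (core S))                            ≡⟨ avoids-appendOnes i (core S) ⟨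
    avoids 1F (consForm (appendOnes i (core S)))             ∎
    where
    S = snocForm s
avoids-decomposition 2F = record
  { θ      = swap-↔
  ; θ-size = λ s t → +-comm (size t) (size s)
  ; θ-true = λ _ _ → refl
  }
avoids-decomposition 3F = record
  { θ      = (↔-id _ ×-↔ mirror-↔) ↔-∘ swap-↔
  ; θ-size = λ s t → trans (cong (size t ℕ.+_) (size-mirror s)) (+-comm (size t) (size s))
  ; θ-true = λ _ _ → refl
  }

everything-finite : AllFinite everything
everything-finite = <-rec _ λ where
  zero    _   → class-zero everything
  (suc n) rec → Decomposition.finite-suc everything-decomposition n rec rec

nonleaf-finite : AllFinite nonleaf
nonleaf-finite zero    = class-zero nonleaf
nonleaf-finite (suc n) = Decomposition.finite-suc nonleaf-decomposition n
  (λ _ → everything-finite _) (λ _ → everything-finite _)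

μ-finite : AllFinite μ
μ-finite zero    = class-zero μ
μ-finite (suc n) = Decomposition.finite-suc μ-decomposition n
  (λ _ → everything-finite _) (λ _ → nonleaf-finite _)

avoids-finite : ∀ i → AllFinite (avoids i)
avoids-finite i = <-rec _ λ where
  zero    _   → class-zero (avoids i)
  (suc n) rec → Decomposition.finite-suc (avoids-decomposition i) n rec (λ _ → μ-finite _)

catalan nonleafs μs : ℕ → ℕ
catalan  = card everything-finite
nonleafs = card nonleaf-finite
μs       = card μ-finite

avoiders : Fin 4 → ℕ → ℕ
avoiders i = card (avoids-finite i)

catalan-suc : ∀ n → catalan (suc n) ≡ (catalan *ᴺ catalan) n
catalan-suc = card-suc everything-decomposition everything-finite everything-finite everything-finite

nonleafs-suc : ∀ n → nonleafs (suc n) ≡ catalan (suc n)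
nonleafs-suc n = trans
  (card-suc nonleaf-decomposition nonleaf-finite everything-finite everything-finite n)
  (sym (catalan-suc n))

μs-suc : ∀ n → μs (suc n) ≡ (catalan *ᴺ nonleafs) n
μs-suc = card-suc μ-decomposition μ-finite everything-finite nonleaf-finite

avoiders-suc : ∀ i n → avoiders i (suc n) ≡ (avoiders i *ᴺ μs) n
avoiders-suc i = card-suc (avoids-decomposition i) (avoids-finite i) (avoids-finite i) μ-finite

-- All four sequences start with 1 and satisfy the same convolution recurrence with `μs`.
avoiders-equinumerous : ∀ i j n → avoiders i n ≡ avoiders j n
avoiders-equinumerous i j = <-rec _ λ where
  zero    _   → refl
  (suc n) rec → trans (avoiders-suc i n) (trans
    (ℕΣ.sum-cong-≗ λ k → cong (ℕ._* μs (n ∸ toℕ k)) (rec (toℕ<n k))) (sym (avoiders-suc j n)))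

-- Generating functions

pos-sum : ∀ {n} (f : Fin n → ℕ) → ℤ.+ ℕΣ.sum f ≡ ℤΣ.sum (ℤ.+_ ∘ f)
pos-sum {zero}  f = refl
pos-sum {suc n} f = trans (ℤ.pos-+ (f zero) _) (cong (λ k → ℤ.+ f zero ℤ.+ k) (pos-sum (f ∘ suc)))

*-generatingFunction : ∀ {F G : PowerSeries} {f g : ℕ → ℕ} n → (∀ {i} → i ≤ n → F i ≡ ℤ.+ f i) →
                       (∀ {i} → i ≤ n → G i ≡ ℤ.+ g i) → (F * G) n ≡ ℤ.+ (f *ᴺ g) n
*-generatingFunction {f = f} {g} n F≡f G≡g = trans
  (ℤΣ.sum-cong-≗ λ i → trans (cong₂ ℤ._*_ (F≡f (≤-pred (toℕ<n i))) (G≡g (m∸n≤m n (toℕ i))))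
                               (sym (ℤ.pos-* (f (toℕ i)) (g (n ∸ toℕ i)))))
  (sym (pos-sum {suc n} λ i → f (toℕ i) ℕ.* g (n ∸ toℕ i)))

X*-zero : ∀ F → (X * F) 0 ≡ 0ℤ
X*-zero F = trans (ℤ.+-identityʳ (0ℤ ℤ.* F 0)) (ℤ.*-zeroˡ (F 0))

X*-suc : ∀ F n → (X * F) (suc n) ≡ F n
X*-suc F n = begin
  0ℤ ℤ.* F (suc n) ℤ.+ (1ℤ ℤ.* F n ℤ.+ rest)
    ≡⟨ cong₂ ℤ._+_ (ℤ.*-zeroˡ (F (suc n))) (cong₂ ℤ._+_ (ℤ.*-identityˡ (F n)) rest≡0) ⟩
  0ℤ ℤ.+ (F n ℤ.+ 0ℤ)
    ≡⟨ ℤ.+-identityˡ _ ⟩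
  F n ℤ.+ 0ℤ
    ≡⟨ ℤ.+-identityʳ (F n) ⟩
  F n ∎
  where
  rest : ℤ
  rest = ℤΣ.sum {n} (λ i → 0ℤ ℤ.* F (n ∸ suc (toℕ i)))
  rest≡0 : rest ≡ 0ℤ
  rest≡0 = trans (ℤΣ.sum-cong-≗ {n} λ i → ℤ.*-zeroˡ (F (n ∸ suc (toℕ i)))) (ℤΣ.sum-replicate-zero n)

X*-*-zero : ∀ F G → (X * F * G) 0 ≡ 0ℤ
X*-*-zero F G = trans (ℤ.+-identityʳ _) (trans (cong (ℤ._* G 0) (X*-zero F)) (ℤ.*-zeroˡ (G 0)))

X*-*-suc : ∀ F G n → (X * F * G) (suc n) ≡ (F * G) n
X*-*-suc F G n = begin
  (X * F) 0 ℤ.* G (suc n) ℤ.+ ℤΣ.sum {suc n} (λ i → (X * F) (suc (toℕ i)) ℤ.* G (n ∸ toℕ i))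
    ≡⟨ cong₂ ℤ._+_ (trans (cong (ℤ._* G (suc n)) (X*-zero F)) (ℤ.*-zeroˡ (G (suc n))))
         (ℤΣ.sum-cong-≗ {suc n} λ i → cong (ℤ._* G (n ∸ toℕ i)) (X*-suc F (toℕ i))) ⟩
  0ℤ ℤ.+ (F * G) n
    ≡⟨ ℤ.+-identityˡ _ ⟩
  (F * G) n ∎

module _ {C : PowerSeries} (catalanGF : IsCatalanGF C) where

  -- The equation C = 1 + xC² determines each coefficient from the earlier ones, so every solution
  -- is the series counting trees.
  C≡catalan : ∀ n → C n ≡ ℤ.+ catalan n
  C≡catalan = <-rec _ λ where
    zero    _   → trans (catalanGF 0) (cong (λ z → 1ℤ ℤ.+ z) (X*-zero (C * C)))
    (suc n) rec → begin
      C (suc n)                       ≡⟨ catalanGF (suc n) ⟩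
      0ℤ ℤ.+ (X * (C * C)) (suc n)    ≡⟨ ℤ.+-identityˡ _ ⟩
      (X * (C * C)) (suc n)           ≡⟨ X*-suc (C * C) n ⟩
      (C * C) n                       ≡⟨ *-generatingFunction n (λ i≤n → rec (s≤s i≤n)) (λ i≤n → rec (s≤s i≤n)) ⟩
      ℤ.+ (catalan *ᴺ catalan) n      ≡⟨ cong ℤ.+_ (catalan-suc n) ⟨
      ℤ.+ catalan (suc n)             ∎

  C-𝟙≡nonleafs : ∀ n → (C - 𝟙) n ≡ ℤ.+ nonleafs n
  C-𝟙≡nonleafs zero    = cong (ℤ._- 1ℤ) (C≡catalan 0)
  C-𝟙≡nonleafs (suc n) = trans (ℤ.+-identityʳ _)
    (trans (C≡catalan (suc n)) (cong ℤ.+_ (sym (nonleafs-suc n))))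

  M≡μs : ∀ n → M C n ≡ ℤ.+ μs n
  M≡μs zero    = cong (λ z → 1ℤ ℤ.+ z) (X*-*-zero C (C - 𝟙))
  M≡μs (suc n) = begin
    0ℤ ℤ.+ (X * C * (C - 𝟙)) (suc n)  ≡⟨ ℤ.+-identityˡ _ ⟩
    (X * C * (C - 𝟙)) (suc n)         ≡⟨ X*-*-suc C (C - 𝟙) n ⟩
    (C * (C - 𝟙)) n                   ≡⟨ *-generatingFunction n (λ {i} _ → C≡catalan i) (λ {i} _ → C-𝟙≡nonleafs i) ⟩
    ℤ.+ (catalan *ᴺ nonleafs) n       ≡⟨ cong ℤ.+_ (μs-suc n) ⟨
    ℤ.+ μs (suc n)                    ∎

  generatingFunction-avoiders : ∀ i → let P = generatingFunction (avoiders i) in P ≈ 𝟙 + X * P * M C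
  generatingFunction-avoiders i zero    =
    sym (cong (λ z → 1ℤ ℤ.+ z) (X*-*-zero (generatingFunction (avoiders i)) (M C)))
  generatingFunction-avoiders i (suc n) = sym (begin
    0ℤ ℤ.+ (X * P * M C) (suc n)  ≡⟨ ℤ.+-identityˡ _ ⟩
    (X * P * M C) (suc n)         ≡⟨ X*-*-suc P (M C) n ⟩
    (P * M C) n                   ≡⟨ *-generatingFunction {f = avoiders i} n (λ _ → refl) (λ {i} _ → M≡μs i) ⟩
    ℤ.+ (avoiders i *ᴺ μs) n      ≡⟨ cong ℤ.+_ (avoiders-suc i n) ⟨
    ℤ.+ avoiders i (suc n)        ∎)
    where
    P = generatingFunction (avoiders i)

Av↔Class-avoids : ∀ i n → Inverse (Av n (classical π₂₃₁ ∷ m i ∷ [])) (setoid (Class (avoids i) n))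
Av↔Class-avoids 0F = Av↔Class m₁-occurs m₁-avoids
Av↔Class-avoids 1F = Av↔Class m₂-occurs m₂-avoids
Av↔Class-avoids 2F = Av↔Class m₃-occurs m₃-avoids
Av↔Class-avoids 3F = Av↔Class m₄-occurs m₄-avoids

mainTheorem9 : Σ[ a ∈ (ℕ → ℕ) ]
    ( ((i : Fin 4) (n : ℕ) → ∣ Av n (classical π₂₃₁ ∷ m i ∷ []) ∣≡ a n)
    × ((C : PowerSeries) → IsCatalanGF C →
    let P = generatingFunction a in
    P ≈ 𝟙 + X * P * M C) )
mainTheorem9 = avoiders 0F
  , (λ i n → subst (∣ Av n (classical π₂₃₁ ∷ m i ∷ []) ∣≡_) (avoiders-equinumerous i 0F n)
               (inverse (Av↔Class-avoids i n) (proj₂ (avoids-finite i n))))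
  , λ C catalanGF → generatingFunction-avoiders catalanGF 0F
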